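{- As $n\to\infty$, \[ N_{\rm bi}(n, 2) \sim \frac{5}{48}\,n^{n+1}. \]
   Context: For integers $r,s\ge 0$ and $k$, $N_{\rm bi}(r,s,k)$ is the number of connected bipartite simple graphs with labeled bipartition $V_1\sqcup V_2$, $|V_1|=r$, $|V_2|=s$, having exactly $r+s+k-1$ edges; equivalently, the number of connected spanning subgraphs of the complete bipartite graph $K_{r,s}$ with $r+s+k-1$ edges (so the Betti number is $k$). Conventions: if $rs=0$, then $N_{\rm bi}(r,s,k)=1$ if $k=0$ and $(r,s)\in\{(1,0),(0,1)\}$, and $0$ otherwise. Define \[ N_{\rm bi}(n,k) := \sum_{r+s=n}\binom{n}{r}N_{\rm bi}(r,s,k), \] which is the coefficient of $x^n/n!$ in $F_k(x,x)$, where $F_k(x,y)=\sum_{r,s\ge0}\frac{N_{\rm bi}(r,s,k)}{r!s!}x^ry^s$. Here $a_n\sim b_n$ means $a_n/b_n\to1$. -}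

module Defs where

open import Data.Bool.Base using (true; false)
open import Data.Empty using (⊥)
open import Data.Fin.Base using (Fin)
open import Data.Fin.Subset using (Subset; _∈_; ∣_∣)
open import Data.Fin.Subset.Properties using (_∈?_)
open import Data.Integer.Base as ℤ using (ℤ; +_; 1ℤ)
import Data.Integer.Properties as ℤ
open import Data.List.Base as List using (List; []; _∷_; _++_; filter; length; upTo; allFin)
open import Data.List.Membership.Propositional using () renaming (_∈_ to _∈ˡ_)
open import Data.List.Membership.Propositional.Properties
  using (∈-++⁺ˡ; ∈-++⁺ʳ; ∈-map⁺; ∈-allFin)
open import Data.List.Relation.Unary.All as All using (all?)
open import Data.List.Relation.Unary.Any using (here; there)
open import Data.Nat.Base as ℕ using (ℕ; zero; suc; _∸_)
open import Data.Nat.Combinatorics using (_C_)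
open import Data.Nat.ListAction using (sum)
open import Data.Product.Base using (∃-syntax; Σ-syntax; _×_; _,_)
open import Data.Rational.Base as ℚ using (ℚ; 0ℚ; 1ℚ)
open import Data.Sum.Base using (_⊎_; inj₁; inj₂)
import Data.Sum.Properties as Sum
import Data.Fin.Properties as Fin
open import Data.Vec.Base as Vec using (Vec; lookup)
open import Relation.Binary.Core using (Rel)
open import Relation.Binary.Definitions using (Decidable; DecidableEquality)
open import Relation.Binary.Construct.Closure.ReflexiveTransitive using (Star; ε; _◅_; _◅◅_)
open import Relation.Binary.PropositionalEquality.Core using (_≡_; refl)
open import Relation.Nullary.Decidable using (no; map′; _×-dec_; _⊎-dec_)
open import Relation.Unary using () renaming (Decidable to Decidable₁)
open import Level using (0ℓ)

-- Reachability along a decidable relation on a finite type is decidable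
-- (Floyd–Warshall): Via vs x y says that y is reachable from x by a walk whose
-- intermediate vertices all belong to vs.

module Reachability {V : Set} (_⟶_ : Rel V 0ℓ)
  (_≟_ : DecidableEquality V) (_⟶?_ : Decidable _⟶_)
  (vertices : List V) (complete : ∀ v → v ∈ˡ vertices) where

  Via : List V → Rel V 0ℓ
  Via []       x y = x ≡ y ⊎ x ⟶ y
  Via (v ∷ vs) x y = Via vs x y ⊎ (Via vs x v × Via vs v y)

  via? : ∀ vs → Decidable (Via vs)
  via? []       x y = (x ≟ y) ⊎-dec (x ⟶? y)
  via? (v ∷ vs) x y = via? vs x y ⊎-dec (via? vs x v ×-dec via? vs v y)

  via⇒star : ∀ vs {x y} → Via vs x y → Star _⟶_ x y
  via⇒star []       (inj₁ refl)    = ε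
  via⇒star []       (inj₂ e)       = e ◅ ε
  via⇒star (v ∷ vs) (inj₁ p)       = via⇒star vs p
  via⇒star (v ∷ vs) (inj₂ (p , q)) = via⇒star vs p ◅◅ via⇒star vs q

  via-base : ∀ vs {x y} → x ≡ y ⊎ x ⟶ y → Via vs x y
  via-base []       p = p
  via-base (v ∷ vs) p = inj₁ (via-base vs p)

  via-trans : ∀ {vs w x y} → w ∈ˡ vs → Via vs x w → Via vs w y → Via vs x y
  via-trans (here refl) (inj₁ p)       (inj₁ q)       = inj₂ (p , q)
  via-trans (here refl) (inj₁ p)       (inj₂ (_ , q)) = inj₂ (p , q)
  via-trans (here refl) (inj₂ (p , _)) (inj₁ q)       = inj₂ (p , q)
  via-trans (here refl) (inj₂ (p , _)) (inj₂ (_ , q)) = inj₂ (p , q)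
  via-trans (there w∈)  (inj₁ p)       (inj₁ q)       = inj₁ (via-trans w∈ p q)
  via-trans (there w∈)  (inj₁ p)       (inj₂ (q , r)) = inj₂ (via-trans w∈ p q , r)
  via-trans (there w∈)  (inj₂ (p , q)) (inj₁ r)       = inj₂ (p , via-trans w∈ q r)
  via-trans (there w∈)  (inj₂ (p , _)) (inj₂ (_ , r)) = inj₂ (p , r)

  star⇒via : ∀ {x y} → Star _⟶_ x y → Via vertices x y
  star⇒via ε                 = via-base vertices (inj₁ refl)
  star⇒via (_◅_ {j = w} e p) = via-trans (complete w) (via-base vertices (inj₂ e)) (star⇒via p)

  star? : Decidable (Star _⟶_)
  star? x y = map′ (via⇒star vertices) star⇒via (via? vertices x y)

-- A spanning subgraph of K_{r,s} is given by its biadjacency matrix: row i is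
-- the set of neighbours in V₂ = Fin s of the vertex i of V₁ = Fin r.

BipartiteGraph : ℕ → ℕ → Set
BipartiteGraph r s = Vec (Subset s) r

Vertex : ℕ → ℕ → Set
Vertex r s = Fin r ⊎ Fin s

module _ {r s : ℕ} where

  Adjacent : BipartiteGraph r s → Rel (Vertex r s) 0ℓ
  Adjacent G (inj₁ i) (inj₂ j) = j ∈ lookup G i
  Adjacent G (inj₂ j) (inj₁ i) = j ∈ lookup G i
  Adjacent G (inj₁ _) (inj₁ _) = ⊥
  Adjacent G (inj₂ _) (inj₂ _) = ⊥

  edgeCount : BipartiteGraph r s → ℕ
  edgeCount G = Vec.sum (Vec.map ∣_∣ G)

  -- The empty graph would count as connected here; N-bi excludes it.
  Connected : BipartiteGraph r s → Set
  Connected G = ∀ u v → Star (Adjacent G) u v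

  adjacent? : ∀ G → Decidable (Adjacent G)
  adjacent? G (inj₁ i) (inj₂ j) = j ∈? lookup G i
  adjacent? G (inj₂ j) (inj₁ i) = j ∈? lookup G i
  adjacent? G (inj₁ _) (inj₁ _) = no λ ()
  adjacent? G (inj₂ _) (inj₂ _) = no λ ()

  allVertices : List (Vertex r s)
  allVertices = List.map inj₁ (allFin r) ++ List.map inj₂ (allFin s)

  ∈-allVertices : ∀ v → v ∈ˡ allVertices
  ∈-allVertices (inj₁ i) = ∈-++⁺ˡ (∈-map⁺ inj₁ (∈-allFin i))
  ∈-allVertices (inj₂ j) = ∈-++⁺ʳ (List.map inj₁ (allFin r)) (∈-map⁺ inj₂ (∈-allFin j))

  connected? : Decidable₁ Connected
  connected? G = map′
    (λ c u v → All.lookup (All.lookup c (∈-allVertices u)) (∈-allVertices v))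
    (λ c → All.tabulate λ {u} _ → All.tabulate λ {v} _ → c u v)
    (all? (λ u → all? (star? u) allVertices) allVertices)
    where open Reachability (Adjacent G) (Sum.≡-dec Fin._≟_ Fin._≟_)
                 (adjacent? G) allVertices ∈-allVertices

  ConnectedWithBetti : ℤ → BipartiteGraph r s → Set
  ConnectedWithBetti k G =
    Connected G × + edgeCount G ≡ + r ℤ.+ + s ℤ.+ k ℤ.- 1ℤ

  connectedWithBetti? : ∀ k → Decidable₁ (ConnectedWithBetti k)
  connectedWithBetti? k G =
    connected? G ×-dec (+ edgeCount G ℤ.≟ + r ℤ.+ + s ℤ.+ k ℤ.- 1ℤ)

-- If xs lists every element of A exactly once, then allVecs xs n lists every
-- vector of length n over A exactly once.

allVecs : {A : Set} → List A → ∀ n → List (Vec A n)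
allVecs xs zero    = Vec.[] ∷ []
allVecs xs (suc n) = List.cartesianProductWith Vec._∷_ xs (allVecs xs n)

allSubsets : ∀ n → List (Subset n)
allSubsets = allVecs (true ∷ false ∷ [])

allGraphs : ∀ r s → List (BipartiteGraph r s)
allGraphs r s = allVecs (allSubsets s) r

N-bi : ℕ → ℕ → ℤ → ℕ
N-bi (suc r) (suc s) k     = length (filter (connectedWithBetti? k) (allGraphs (suc r) (suc s)))
N-bi 1       0       (+ 0) = 1
N-bi 0       1       (+ 0) = 1
N-bi _       _       _     = 0

N-bi-total : ℕ → ℤ → ℕ
N-bi-total n k = sum (List.map (λ r → (n C r) ℕ.* N-bi r (n ∸ r) k) (upTo (suc n)))

fromℕ : ℕ → ℚ
fromℕ m = + m ℚ./ 1

-- a n / b n → 1; the quotient is only required to be defined for large n.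

infix 4 _∼_
_∼_ : (ℕ → ℚ) → (ℕ → ℚ) → Set
a ∼ b = ∀ (δ : ℚ) → 0ℚ ℚ.< δ → ∃[ n₀ ] ∀ n → n₀ ℕ.≤ n →
  Σ[ b≢0 ∈ ℚ.NonZero (b n) ] ℚ.∣ ℚ._÷_ (a n) (b n) {{b≢0}} ℚ.- 1ℚ ∣ ℚ.< δ

-- Explore a bipartite graph from a set of marked vertices, repeatedly deleting a marked vertex and
-- marking its neighbours. Summed over all ways to divide m unmarked vertices among the two sides,
-- this gives a recurrence for the number of graphs with a and b marked vertices on the two sides
-- whose components all meet a mark. With T = x exp(T), spanning forests have the exponential
-- generating function exp((a+b)T), and an exploration step averages over a Poisson number of new
-- vertices of mean T; so k edges beyond a forest contribute exp((a+b)T) times a polynomial in a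
-- and b over rational functions of T. Solving for k = 2 and one marked vertex, the coefficient of
-- T^l is (5/768) l^4 + O(l^3). Finally, for t_l = n(n-1)...(n-l+1)/n^l the telescoping identity
-- l t_l = n (t_l - t_{l+1}) evaluates the resulting sums of l^k t_l to leading order.
module Submission where

open import Defs

-- Connectivity is lost when a vertex is deleted, whereas the property that every component meets a
-- mark survives once the neighbours are marked. Summing over the sides of the unmarked vertices
-- replaces the two tree functions of a bipartite problem by the single T. Bipartite cycles bring in
-- denominators with factors 1 - T and 1 + T, so the coefficient of T^l is a polynomial in l only on
-- each parity class; hence even and odd powers are kept apart. All arithmetic is in natural
-- numbers: 144 clears the denominators, and differences are stated additively. The solved series
-- are not derived but verified: the recurrences reduce to finitely many equalities of normal forms,
-- which hold by computation. The constant is 2 * 8 * 5/768 = 5/48, where 2 stands for the side of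
-- the root and 8 n^(n+1) is the leading term that the coefficients l^4 produce, the sum of l^5 t_l
-- being 8 n^3 to leading order.

module BicyclicCount where

  open import Data.Bool.Base using (Bool; true; false; _∨_)
  open import Data.Fin.Base using (Fin; zero; suc; punchIn)
  import Data.Fin.Properties as Fin
  open import Data.Fin.Subset using (Subset; ∣_∣; _∪_; ∁)
  open import Data.Integer.Base as ℤ using ()
  import Data.Integer.Properties as ℤ
  import Data.Integer.Tactic.RingSolver as ℤSolver
  open import Data.List.Base as List using (List; []; _∷_; _++_; filter; length; cartesianProductWith; applyUpTo)
  import Data.List.Properties as List
  open import Data.Nat.Base
  open import Data.Nat.Combinatorics using (nCk+nC[k+1]≡[n+1]C[k+1]; k>n⇒nCk≡0) renaming (_C_ to _choose_)
  open import Data.Nat.ListAction using (sum)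
  open import Data.Nat.Properties
  open import Data.Nat.Tactic.RingSolver using (solve-∀)
  open import Data.Product.Base using (_×_; _,_; proj₁; proj₂; Σ-syntax)
  import Data.Product.Properties as Product
  open import Data.Rational.Base as ℚ using (ℚ; mkℚ; 0ℚ; 1ℚ; toℚᵘ; fromℚᵘ)
  import Data.Rational.Properties as ℚ
  open import Data.Rational.Unnormalised.Base as ℚᵘ using (mkℚᵘ; *≡*; *<*)
  import Data.Rational.Unnormalised.Properties as ℚᵘ
  open import Data.Sum.Base using (inj₁; inj₂; [_,_]′)
  import Data.Sum.Properties as Sum
  open import Data.Vec.Base as Vec using (Vec; []; _∷_; lookup; insertAt; zipWith; replicate)
  import Data.Vec.Functional as F
  import Data.Vec.Functional.Properties as F
  open import Data.Vec.Properties
    using (insertAt-lookup; insertAt-punchIn; lookup-zipWith; lookup-replicate; lookup⇒[]=; []=⇒lookup)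
  open import Function.Base using (_∘_; flip; id)
  open import Function.Bundles using (mk⇔)
  open import Relation.Binary.Construct.Closure.ReflexiveTransitive using (Star; ε; _◅_; _◅◅_; reverse)
  open import Relation.Binary.PropositionalEquality
  open import Relation.Nullary.Decidable
  open import Relation.Nullary.Negation using (¬_; contradiction)

  -- Binomial convolutions

  -- The binomial convolution Σ_{i+j=n} (n choose i) f i j, defined through Pascal's rule.
  split : ℕ → (ℕ → ℕ → ℕ) → ℕ
  split zero    f = f 0 0
  split (suc n) f = split n (λ i j → f (suc i) j) + split n (λ i j → f i (suc j))

  split-cong : ∀ n {f g : ℕ → ℕ → ℕ} → (∀ i j → i + j ≡ n → f i j ≡ g i j) → split n f ≡ split n g
  split-cong zero    f≗g = f≗g 0 0 refl
  split-cong (suc n) f≗g = cong₂ _+_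
    (split-cong n λ i j eq → f≗g (suc i) j (cong suc eq))
    (split-cong n λ i j eq → f≗g i (suc j) (trans (+-suc i j) (cong suc eq)))

  split-0 : ∀ n → split n (λ _ _ → 0) ≡ 0
  split-0 zero    = refl
  split-0 (suc n) = cong₂ _+_ (split-0 n) (split-0 n)

  interchange : ∀ a b c d → (a + b) + (c + d) ≡ (a + c) + (b + d)
  interchange = solve-∀

  split-+ : ∀ n f g → split n (λ i j → f i j + g i j) ≡ split n f + split n g
  split-+ zero    f g = refl
  split-+ (suc n) f g = trans (cong₂ _+_ (split-+ n _ _) (split-+ n _ _))
    (interchange (split n λ i j → f (suc i) j) _ _ _)

  split-* : ∀ n c f → split n (λ i j → c * f i j) ≡ c * split n f
  split-* zero    c f = refl
  split-* (suc n) c f = trans (cong₂ _+_ (split-* n c _) (split-* n c _)) (sym (*-distribˡ-+ c _ _))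

  split-swap : ∀ m n (f : ℕ → ℕ → ℕ → ℕ → ℕ) →
    split m (λ i j → split n (f i j)) ≡ split n (λ k l → split m (λ i j → f i j k l))
  split-swap zero    n f = refl
  split-swap (suc m) n f = trans
    (cong₂ _+_ (split-swap m n _) (split-swap m n _))
    (sym (split-+ n _ _))

  split-assoc : ∀ n (f : ℕ → ℕ → ℕ → ℕ) →
    split n (λ i j → split j (f i)) ≡ split n (λ k l → split l (λ i j → f i k j))
  split-assoc zero    f = refl
  split-assoc (suc n) f = begin
    split n (λ i j → split j (f (suc i)))
      + split n (λ i j → split j (λ k l → f i (suc k) l) + split j (λ k l → f i k (suc l)))
      ≡⟨ cong₂ _+_ (split-assoc n _) (trans (split-+ n _ _) (cong₂ _+_ (split-assoc n _) (split-assoc n _))) ⟩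
    X + (Y + Z) ≡⟨ x+[y+z] X Y Z ⟩
    Y + (X + Z) ≡⟨ cong (Y +_) (sym (split-+ n _ _)) ⟩
    split (suc n) (λ k l → split l (λ i j → f i k j)) ∎
    where
    open ≡-Reasoning
    X = split n (λ k l → split l (λ i j → f (suc i) k j))
    Y = split n (λ k l → split l (λ i j → f i (suc k) j))
    Z = split n (λ k l → split l (λ i j → f i k (suc j)))
    x+[y+z] : ∀ x y z → x + (y + z) ≡ y + (x + z)
    x+[y+z] = solve-∀

  split-flip : ∀ n f → split n f ≡ split n (λ i j → f j i)
  split-flip zero    f = refl
  split-flip (suc n) f = trans (+-comm (split n _) _) (cong₂ _+_ (split-flip n _) (split-flip n _))

  -- i (n choose i) = n (n-1 choose i-1).
  split-absorbʳ : ∀ n f → split (suc n) (λ i j → j * f i (pred j)) ≡ suc n * split n f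
  split-absorbʳ zero    f = refl
  split-absorbʳ (suc n) f = begin
    split (suc n) (λ i j → j * f (suc i) (pred j)) + split (suc n) (λ i j → suc j * f i j)
      ≡⟨ cong₂ _+_ (split-absorbʳ n _) (trans (split-+ (suc n) f (λ i j → j * f i j)) (cong (split (suc n) f +_)
           (trans (split-cong (suc n) pred-suc) (split-absorbʳ n _)))) ⟩
    suc n * A + ((A + B) + suc n * B) ≡⟨ ring n A B ⟩
    suc (suc n) * (A + B) ∎
    where
    open ≡-Reasoning
    A = split n (λ i j → f (suc i) j)
    B = split n (λ i j → f i (suc j))
    pred-suc : ∀ i j → i + j ≡ suc n → j * f i j ≡ j * f i (suc (pred j))
    pred-suc i zero    _ = refl
    pred-suc i (suc j) _ = refl
    ring : ∀ n A B → suc n * A + ((A + B) + suc n * B) ≡ suc (suc n) * (A + B)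
    ring = solve-∀

  split-absorbˡ : ∀ n f → split (suc n) (λ i j → i * f (pred i) j) ≡ suc n * split n f
  split-absorbˡ n f = begin
    split (suc n) (λ i j → i * f (pred i) j) ≡⟨ split-flip (suc n) (λ i j → i * f (pred i) j) ⟩
    split (suc n) (λ i j → j * f (pred j) i) ≡⟨ split-absorbʳ n (λ i j → f j i) ⟩
    suc n * split n (λ i j → f j i)          ≡⟨ cong (suc n *_) (split-flip n _) ⟩
    suc n * split n f                        ∎
    where open ≡-Reasoning

  sum-applyUpTo-+ : ∀ n f g → sum (applyUpTo (λ i → f i + g i) n) ≡ sum (applyUpTo f n) + sum (applyUpTo g n)
  sum-applyUpTo-+ zero    f g = refl
  sum-applyUpTo-+ (suc n) f g = trans (cong (f 0 + g 0 +_) (sum-applyUpTo-+ n _ _))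
    (interchange (f 0) (g 0) _ _)

  sum-applyUpTo-cong : ∀ n {f g : ℕ → ℕ} → (∀ i → i < n → f i ≡ g i) → sum (applyUpTo f n) ≡ sum (applyUpTo g n)
  sum-applyUpTo-cong zero    f≗g = refl
  sum-applyUpTo-cong (suc n) f≗g = cong₂ _+_ (f≗g 0 z<s) (sum-applyUpTo-cong n λ i i<n → f≗g (suc i) (s<s i<n))

  sum-applyUpTo-∷ʳ : ∀ n f → sum (applyUpTo f (suc n)) ≡ sum (applyUpTo f n) + f n
  sum-applyUpTo-∷ʳ zero    f = +-comm (f 0) 0
  sum-applyUpTo-∷ʳ (suc n) f = trans (cong (f 0 +_) (sum-applyUpTo-∷ʳ n (f ∘ suc))) (sym (+-assoc (f 0) _ _))

  binomialSum : ℕ → (ℕ → ℕ → ℕ) → ℕ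
  binomialSum n f = sum (applyUpTo (λ r → (n choose r) * f r (n ∸ r)) (suc n))

  binomialSum≡split : ∀ n f → binomialSum n f ≡ split n f
  binomialSum≡split zero    f = trans (+-identityʳ _) (*-identityˡ _)
  binomialSum≡split (suc n) f = begin
    1 * f 0 (suc n) + sum (applyUpTo (λ r → (suc n choose suc r) * f (suc r) (n ∸ r)) (suc n))
      ≡⟨ cong (1 * f 0 (suc n) +_) (trans
           (sum-applyUpTo-cong (suc n) λ r _ → trans (cong (_* f (suc r) (n ∸ r)) (sym (nCk+nC[k+1]≡[n+1]C[k+1] n r)))
              (*-distribʳ-+ (f (suc r) (n ∸ r)) (n choose r) (n choose suc r)))
           (sum-applyUpTo-+ (suc n) (λ r → (n choose r) * f (suc r) (n ∸ r)) (λ r → (n choose suc r) * f (suc r) (n ∸ r)))) ⟩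
    1 * f 0 (suc n) + (X + sum (applyUpTo (λ r → (n choose suc r) * f (suc r) (n ∸ r)) (suc n)))
      ≡⟨ cong (λ z → 1 * f 0 (suc n) + (X + z)) (trans (sum-applyUpTo-∷ʳ n _)
           (trans (cong₂ _+_ (sum-applyUpTo-cong n λ r r<n → cong (λ k → (n choose suc r) * f (suc r) k) (∸-suc r<n))
             (cong (_* f (suc n) (n ∸ n)) (k>n⇒nCk≡0 (n<1+n n)))) (+-identityʳ _))) ⟩
    1 * f 0 (suc n) + (X + Y)
      ≡⟨ x+[y+z] (1 * f 0 (suc n)) X Y ⟩
    X + (1 * f 0 (suc n) + Y)
      ≡⟨ cong₂ _+_ (binomialSum≡split n (λ i j → f (suc i) j)) (binomialSum≡split n (λ i j → f i (suc j))) ⟩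
    split (suc n) f ∎
    where
    open ≡-Reasoning
    X = sum (applyUpTo (λ r → (n choose r) * f (suc r) (n ∸ r)) (suc n))
    Y = sum (applyUpTo (λ r → (n choose suc r) * f (suc r) (suc (n ∸ suc r))) n)
    ∸-suc : ∀ {r n} → r < n → n ∸ r ≡ suc (n ∸ suc r)
    ∸-suc {zero}  (s≤s _) = refl
    ∸-suc {suc r} (s≤s r<n) = ∸-suc r<n
    x+[y+z] : ∀ x y z → x + (y + z) ≡ y + (x + z)
    x+[y+z] = solve-∀

  -- Sums over graphs

  ∑ : {A : Set} → List A → (A → ℕ) → ℕ
  ∑ []       f = 0
  ∑ (x ∷ xs) f = f x + ∑ xs f

  module _ {A : Set} where

    ∑-cong : ∀ (xs : List A) {f g : A → ℕ} → (∀ x → f x ≡ g x) → ∑ xs f ≡ ∑ xs g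
    ∑-cong []       f≗g = refl
    ∑-cong (x ∷ xs) f≗g = cong₂ _+_ (f≗g x) (∑-cong xs f≗g)

    ∑-0 : ∀ (xs : List A) → ∑ xs (λ _ → 0) ≡ 0
    ∑-0 []       = refl
    ∑-0 (x ∷ xs) = ∑-0 xs

    ∑-+ : ∀ (xs : List A) (f g : A → ℕ) → ∑ xs (λ x → f x + g x) ≡ ∑ xs f + ∑ xs g
    ∑-+ []       f g = refl
    ∑-+ (x ∷ xs) f g = trans (cong (f x + g x +_) (∑-+ xs f g)) (interchange (f x) (g x) _ _)

    ∑-++ : ∀ (xs ys : List A) (f : A → ℕ) → ∑ (xs ++ ys) f ≡ ∑ xs f + ∑ ys f
    ∑-++ []       ys f = refl
    ∑-++ (x ∷ xs) ys f = trans (cong (f x +_) (∑-++ xs ys f)) (sym (+-assoc (f x) _ _))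

    ∑-map : ∀ {B : Set} (xs : List B) (h : B → A) (f : A → ℕ) → ∑ (List.map h xs) f ≡ ∑ xs (f ∘ h)
    ∑-map []       h f = refl
    ∑-map (x ∷ xs) h f = cong (f (h x) +_) (∑-map xs h f)

  module _ {A B : Set} where

    ∑-swap : ∀ (xs : List A) (ys : List B) (f : A → B → ℕ) →
      ∑ xs (λ x → ∑ ys (f x)) ≡ ∑ ys (λ y → ∑ xs (λ x → f x y))
    ∑-swap []       ys f = sym (∑-0 ys)
    ∑-swap (x ∷ xs) ys f = trans (cong (∑ ys (f x) +_) (∑-swap xs ys f)) (sym (∑-+ ys (f x) _))

    ∑-cartesianProductWith : ∀ {C : Set} (h : A → B → C) xs ys (f : C → ℕ) →
      ∑ (cartesianProductWith h xs ys) f ≡ ∑ xs (λ x → ∑ ys (λ y → f (h x y)))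
    ∑-cartesianProductWith h []       ys f = refl
    ∑-cartesianProductWith h (x ∷ xs) ys f = trans (∑-++ (List.map (h x) ys) _ f)
      (cong₂ _+_ (∑-map ys (h x) f) (∑-cartesianProductWith h xs ys f))

  -- Sums over different coordinates commute, so any one may be singled out. This allows an
  -- arbitrary marked row to be removed, not only the first.
  ∑-insertAt : ∀ {A : Set} (xs : List A) {n} (i : Fin (suc n)) (f : Vec A (suc n) → ℕ) →
    ∑ (allVecs xs (suc n)) f ≡ ∑ xs (λ x → ∑ (allVecs xs n) (λ v → f (insertAt v i x)))
  ∑-insertAt xs {n} zero f = ∑-cartesianProductWith Vec._∷_ xs (allVecs xs n) f
  ∑-insertAt xs {suc n} (suc i) f = begin
    ∑ (allVecs xs (2+ n)) f
      ≡⟨ ∑-cartesianProductWith Vec._∷_ xs (allVecs xs (suc n)) f ⟩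
    ∑ xs (λ y → ∑ (allVecs xs (suc n)) (λ v → f (y ∷ v)))
      ≡⟨ ∑-cong xs (λ y → ∑-insertAt xs i (λ v → f (y ∷ v))) ⟩
    ∑ xs (λ y → ∑ xs (λ x → ∑ (allVecs xs n) (λ v → f (y ∷ insertAt v i x))))
      ≡⟨ ∑-swap xs xs (λ y x → ∑ (allVecs xs n) (λ v → f (y ∷ insertAt v i x))) ⟩
    ∑ xs (λ x → ∑ xs (λ y → ∑ (allVecs xs n) (λ v → f (y ∷ insertAt v i x))))
      ≡⟨ ∑-cong xs (λ x → ∑-cartesianProductWith Vec._∷_ xs (allVecs xs n) (λ v → f (insertAt v (suc i) x))) ⟨
    ∑ xs (λ x → ∑ (allVecs xs (suc n)) (λ v → f (insertAt v (suc i) x))) ∎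
    where open ≡-Reasoning

  insertColumn : ∀ {r s} → Fin (suc s) → Subset r → BipartiteGraph r s → BipartiteGraph r (suc s)
  insertColumn j c G = zipWith (λ x row → insertAt row j x) c G

  -- Induction on the rows: entry `j` of each row is summed separately, and these bits assemble to
  -- the column `c`.
  ∑-insertColumn : ∀ r {s} (j : Fin (suc s)) (f : BipartiteGraph r (suc s) → ℕ) →
    ∑ (allGraphs r (suc s)) f ≡ ∑ (allSubsets r) (λ c → ∑ (allGraphs r s) (λ G → f (insertColumn j c G)))
  ∑-insertColumn zero    j f = sym (+-identityʳ _)
  ∑-insertColumn (suc r) {s} j f = begin
    ∑ (allGraphs (suc r) (suc s)) f
      ≡⟨ ∑-insertAt (allSubsets (suc s)) zero f ⟩
    ∑ (allSubsets (suc s)) (λ row → ∑ (allGraphs r (suc s)) (λ G → f (row ∷ G)))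
      ≡⟨ ∑-insertAt bits j (λ row → ∑ (allGraphs r (suc s)) (λ G → f (row ∷ G))) ⟩
    ∑ bits (λ x → ∑ (allSubsets s) (λ row → ∑ (allGraphs r (suc s)) (λ G → f (insertAt row j x ∷ G))))
      ≡⟨ ∑-cong bits (λ x → ∑-cong (allSubsets s) λ row → ∑-insertColumn r j (λ G → f (insertAt row j x ∷ G))) ⟩
    ∑ bits (λ x → ∑ (allSubsets s) (λ row → ∑ (allSubsets r) (λ c → ∑ (allGraphs r s) (h x row c))))
      ≡⟨ ∑-cong bits (λ x → ∑-swap (allSubsets s) (allSubsets r) (λ row c → ∑ (allGraphs r s) (h x row c))) ⟩
    ∑ bits (λ x → ∑ (allSubsets r) (λ c → ∑ (allSubsets s) (λ row → ∑ (allGraphs r s) (h x row c))))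
      ≡⟨ ∑-cong bits (λ x → ∑-cong (allSubsets r) λ c → ∑-insertAt (allSubsets s) {r} zero (λ G → f (insertColumn j (x ∷ c) G))) ⟨
    ∑ bits (λ x → ∑ (allSubsets r) (λ c → ∑ (allGraphs (suc r) s) (λ G → f (insertColumn j (x ∷ c) G))))
      ≡⟨ ∑-insertAt bits {r} zero (λ c → ∑ (allGraphs (suc r) s) (λ G → f (insertColumn j c G))) ⟨
    ∑ (allSubsets (suc r)) (λ c → ∑ (allGraphs (suc r) s) (λ G → f (insertColumn j c G))) ∎
    where
    open ≡-Reasoning
    bits = true ∷ false ∷ []
    h : Bool → Subset s → Subset r → BipartiteGraph r s → ℕ
    h x row c G = f (insertAt row j x ∷ insertColumn j c G)

  ind : {P : Set} → Dec P → ℕ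
  ind (yes _) = 1
  ind (no  _) = 0

  ind-cong : {P Q : Set} → (P → Q) → (Q → P) → (p? : Dec P) (q? : Dec Q) → ind p? ≡ ind q?
  ind-cong to from (yes p) (yes q) = refl
  ind-cong to from (yes p) (no ¬q) = contradiction (to p) ¬q
  ind-cong to from (no ¬p) (yes q) = contradiction (from q) ¬p
  ind-cong to from (no ¬p) (no ¬q) = refl

  ind-no : {P : Set} → ¬ P → (p? : Dec P) → ind p? ≡ 0
  ind-no ¬p (yes p) = contradiction p ¬p
  ind-no ¬p (no _)  = refl

  ind-× : {P Q : Set} (p? : Dec P) (q? : Dec Q) → ind (p? ×-dec q?) ≡ ind p? * ind q?
  ind-× (yes p) (yes q) = refl
  ind-× (yes p) (no ¬q) = refl
  ind-× (no ¬p) (yes q) = refl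
  ind-× (no ¬p) (no ¬q) = refl

  length-filter : ∀ {A : Set} {P : A → Set} (P? : ∀ x → Dec (P x)) xs →
    length (filter P? xs) ≡ ∑ xs (ind ∘ P?)
  length-filter P? [] = refl
  length-filter P? (x ∷ xs) with P? x
  ... | yes _ = cong suc (length-filter P? xs)
  ... | no  _ = length-filter P? xs

  -- Marked sets that meet every component

  module _ {r s : ℕ} where

    -- Every component of the bipartite graph E meets the set of marked vertices A ⊔ B,
    -- expressed through unions of components X ⊔ Y.
    Spanned : (Fin r → Bool) → (Fin s → Bool) → (Fin r → Fin s → Bool) → Set
    Spanned A B E = ∀ (X : Fin r → Bool) (Y : Fin s → Bool) →
      (∀ i → A i ≡ true → X i ≡ true) → (∀ j → B j ≡ true → Y j ≡ true) →
      (∀ i j → E i j ≡ true → X i ≡ Y j) →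
      (∀ i → X i ≡ true) × (∀ j → Y j ≡ true)

    -- The conclusion is `Spanned B A (flip E)` written out; it lets the column case reuse the
    -- deletion lemmas for rows.
    Spanned-flip : ∀ {A B E} → Spanned A B E → ∀ (X : Fin s → Bool) (Y : Fin r → Bool) →
      (∀ i → B i ≡ true → X i ≡ true) → (∀ j → A j ≡ true → Y j ≡ true) →
      (∀ i j → E j i ≡ true → X i ≡ Y j) →
      (∀ i → X i ≡ true) × (∀ j → Y j ≡ true)
    Spanned-flip sp X Y B⊆X A⊆Y closed with sp Y X A⊆Y B⊆X (λ i j e → sym (closed j i e))
    ... | p , q = q , p

  punchIn-elim : ∀ {n} (P : Fin (suc n) → Set) i → P i → (∀ j → P (punchIn i j)) → ∀ k → P k
  punchIn-elim P zero    Pi Pj zero    = Pi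
  punchIn-elim P zero    Pi Pj (suc k) = Pj k
  punchIn-elim {suc n} P (suc i) Pi Pj zero    = Pj zero
  punchIn-elim {suc n} P (suc i) Pi Pj (suc k) = punchIn-elim (P ∘ suc) i Pi (Pj ∘ suc) k

  true-∨ : ∀ x {y} → y ≡ true → x ∨ y ≡ true
  true-∨ true  _  = refl
  true-∨ false eq = eq

  true-∨ˡ : ∀ {x} y → x ≡ true → x ∨ y ≡ true
  true-∨ˡ y refl = refl

  module _ {r s : ℕ} {A : Fin (suc r) → Bool} {A′ : Fin r → Bool} {B B′ : Fin s → Bool}
    {E : Fin (suc r) → Fin s → Bool} {E′ : Fin r → Fin s → Bool} (i : Fin (suc r))
    (Aᵢ : A i ≡ true) (A-rest : ∀ k → A (punchIn i k) ≡ A′ k)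
    (E-rest : ∀ k j → E (punchIn i k) j ≡ E′ k j)
    (B-new : ∀ j → B′ j ≡ B j ∨ E i j) where

    -- A closed pair of the smaller graph is extended by placing the deleted vertex `i` inside: its
    -- neighbours are all marked by `B′`, so its edges stay within the pair.
    Spanned-remove : Spanned A B E → Spanned A′ B′ E′
    Spanned-remove sp X′ Y A′⊆X′ B′⊆Y closed′ = (λ k → trans (sym (X-rest k)) (proj₁ all (punchIn i k))) , proj₂ all
      where
      X = F.insertAt X′ i true
      Xᵢ = F.insertAt-lookup X′ i true
      X-rest = F.insertAt-punchIn X′ i true
      all = sp X Y
        (punchIn-elim (λ k → A k ≡ true → X k ≡ true) i (λ _ → Xᵢ)
          λ k Ak → trans (X-rest k) (A′⊆X′ k (trans (sym (A-rest k)) Ak)))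
        (λ j Bj → B′⊆Y j (trans (B-new j) (true-∨ˡ _ Bj)))
        (punchIn-elim (λ k → ∀ j → E k j ≡ true → X k ≡ Y j) i
          (λ j e → trans Xᵢ (sym (B′⊆Y j (trans (B-new j) (true-∨ (B j) e)))))
          λ k j e → trans (X-rest k) (closed′ k j (trans (sym (E-rest k j)) e)))

    -- The marked vertex `i` lies in `X`, and closure along its edges forces its neighbours into
    -- `Y`; thus `Y` contains every new mark.
    Spanned-insert : Spanned A′ B′ E′ → Spanned A B E
    Spanned-insert sp X Y A⊆X B⊆Y closed =
      punchIn-elim (λ k → X k ≡ true) i Xᵢ (proj₁ all) , proj₂ all
      where
      Xᵢ = A⊆X i Aᵢ
      B′⊆Y : ∀ j → B′ j ≡ true → Y j ≡ true
      B′⊆Y j B′j with B j in Bj | E i j in Eij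
      ... | true  | _     = B⊆Y j Bj
      ... | false | true  = trans (sym (closed i j Eij)) Xᵢ
      ... | false | false with () ← trans (sym B′j) (trans (B-new j) (cong₂ _∨_ Bj Eij))
      all = sp (X ∘ punchIn i) Y
        (λ k A′k → A⊆X (punchIn i k) (trans (A-rest k) A′k)) B′⊆Y
        (λ k j e → closed (punchIn i k) j (trans (E-rest k j) e))

  -- Exploring a graph from its marked vertices

  size cosize : ∀ {n} → Subset n → ℕ
  size   A = ∣ A ∣
  cosize A = ∣ ∁ A ∣

  ∑-bit : ∀ s (f : Subset (suc s) → ℕ) →
    ∑ (allSubsets (suc s)) f ≡ ∑ (allSubsets s) (λ x → f (true ∷ x)) + ∑ (allSubsets s) (λ x → f (false ∷ x))
  ∑-bit s f = trans (∑-insertAt (true ∷ false ∷ []) zero f) (cong (∑ (allSubsets s) (λ x → f (true ∷ x)) +_) (+-identityʳ _))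

  -- The neighbourhood `x` of a deleted vertex has `i` elements in `B` and `j` outside: all of them
  -- account for edges, but only the `j` are newly marked.
  ∑-∪ : ∀ {s} (B : Subset s) (f : ℕ → ℕ → ℕ → ℕ) →
    ∑ (allSubsets s) (λ x → f (size x) (cosize (B ∪ x)) (size (B ∪ x))) ≡
    split (size B) (λ i _ → split (cosize B) (λ j s′ → f (i + j) s′ ((size B) + j)))
  ∑-∪ []          f = +-identityʳ _
  ∑-∪ {suc s} (true  ∷ B) f = begin
    ∑ (allSubsets (suc s)) (λ x → f (size x) (cosize ((true ∷ B) ∪ x)) (size ((true ∷ B) ∪ x)))
      ≡⟨ ∑-bit s _ ⟩
    ∑ (allSubsets s) (λ x → f (suc (size x)) (cosize (B ∪ x)) (suc (size (B ∪ x))))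
      + ∑ (allSubsets s) (λ x → f (size x) (cosize (B ∪ x)) (suc (size (B ∪ x))))
      ≡⟨ cong₂ _+_ (∑-∪ B (λ e u t → f (suc e) u (suc t))) (∑-∪ B (λ e u t → f e u (suc t))) ⟩
    split (suc (size B)) (λ i _ → split (cosize B) (λ j s′ → f (i + j) s′ (suc (size B) + j))) ∎
    where open ≡-Reasoning
  ∑-∪ {suc s} (false ∷ B) f = begin
    ∑ (allSubsets (suc s)) (λ x → f (size x) (cosize ((false ∷ B) ∪ x)) (size ((false ∷ B) ∪ x)))
      ≡⟨ ∑-bit s _ ⟩
    ∑ (allSubsets s) (λ x → f (suc (size x)) (cosize (B ∪ x)) (suc (size (B ∪ x))))
      + ∑ (allSubsets s) (λ x → f (size x) (suc (cosize (B ∪ x))) (size (B ∪ x)))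
      ≡⟨ cong₂ _+_ (∑-∪ B (λ e u t → f (suc e) u (suc t))) (∑-∪ B (λ e u t → f e (suc u) t)) ⟩
    split (size B) (λ i _ → split (cosize B) (λ j s′ → f (suc (i + j)) s′ (suc ((size B) + j))))
      + split (size B) (λ i _ → split (cosize B) (λ j s′ → f (i + j) (suc s′) ((size B) + j)))
      ≡⟨ split-+ (size B) _ _ ⟨
    split (size B) (λ i _ → split (cosize B) (λ j s′ → f (suc (i + j)) s′ (suc ((size B) + j)))
      + split (cosize B) (λ j s′ → f (i + j) (suc s′) ((size B) + j)))
      ≡⟨ split-cong (size B) (λ i _ _ → cong (_+ split (cosize B) (λ j s′ → f (i + j) (suc s′) ((size B) + j)))
           (split-cong (cosize B) λ j s′ _ → cong₂ (λ e t → f e s′ t) (+-suc i j) (+-suc (size B) j))) ⟨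
    split (size B) (λ i _ → split (suc (cosize B)) (λ j s′ → f (i + j) s′ ((size B) + j))) ∎
    where open ≡-Reasoning

  -- The number of bipartite graphs with a marked and r unmarked rows, b marked and s unmarked
  -- columns, all of whose components meet a marked vertex, weighted by φ of the number of edges.
  -- Deleting a marked vertex marks its neighbours. The first argument is r + s + a + b.
  spannedCount : ℕ → (r s a b : ℕ) → (ℕ → ℕ) → ℕ
  spannedCount zero    r s a       b       φ = φ 0
  spannedCount (suc n) r s zero    zero    φ = 0
  spannedCount (suc n) r s zero    (suc b) φ = split r λ j r′ → spannedCount n r′ s j b λ e → φ (j + e)
  spannedCount (suc n) r s (suc a) b       φ =
    split b λ i _ → split s λ j s′ → spannedCount n r s′ a (b + j) λ e → φ (i + j + e)

  -- This view exhibits a nonempty set as an insertion, the form in which `∑-insertAt` and the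
  -- deletion lemmas apply.
  data Marked : ∀ {r} → Subset r → Set where
    marked : ∀ {r} (A : Subset r) i → Marked (insertAt A i true)

  findMarked : ∀ {r a} (A : Subset r) → (size A) ≡ suc a → Marked A
  findMarked (true  ∷ A) _  = marked A zero
  findMarked (false ∷ A) eq with findMarked A eq
  ... | marked A′ i = marked (false ∷ A′) (suc i)

  unmarked : ∀ {r} (A : Subset r) → (size A) ≡ 0 → ∀ i → lookup A i ≢ true
  unmarked (false ∷ A) eq (suc i) = unmarked A eq i

  size-insertAt : ∀ {r} (A : Subset r) i x → (size (insertAt A i x)) ≡ (size (x ∷ A))
  size-insertAt A           zero    x     = refl
  size-insertAt (true ∷ A)  (suc i) true  = cong suc (size-insertAt A i true)
  size-insertAt (true ∷ A)  (suc i) false = cong suc (size-insertAt A i false)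
  size-insertAt (false ∷ A) (suc i) true  = size-insertAt A i true
  size-insertAt (false ∷ A) (suc i) false = size-insertAt A i false

  cosize-insertAt : ∀ {r} (A : Subset r) i → (cosize (insertAt A i true)) ≡ (cosize A)
  cosize-insertAt A           zero    = refl
  cosize-insertAt (true ∷ A)  (suc i) = cosize-insertAt A i
  cosize-insertAt (false ∷ A) (suc i) = cong suc (cosize-insertAt A i)

  edgeCount-insertAt : ∀ {r s} (G : BipartiteGraph r s) i x → edgeCount (insertAt G i x) ≡ (size x) + edgeCount G
  edgeCount-insertAt G       zero    x = refl
  edgeCount-insertAt (y ∷ G) (suc i) x = begin
    (size y) + edgeCount (insertAt G i x) ≡⟨ cong ((size y) +_) (edgeCount-insertAt G i x) ⟩
    (size y) + ((size x) + edgeCount G)      ≡⟨ ring (size y) (size x) (edgeCount G) ⟩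
    (size x) + ((size y) + edgeCount G)      ∎
    where
    open ≡-Reasoning
    ring : ∀ a b c → a + (b + c) ≡ b + (a + c)
    ring = solve-∀

  edgeCount-insertColumn : ∀ {r s} (G : BipartiteGraph r s) j c →
    edgeCount (insertColumn j c G) ≡ (size c) + edgeCount G
  edgeCount-insertColumn []      j []      = refl
  edgeCount-insertColumn (y ∷ G) j (true ∷ c) = trans
    (cong₂ _+_ (size-insertAt y j true) (edgeCount-insertColumn G j c)) (ring (size y) (size c) (edgeCount G))
    where
    ring : ∀ a b c → suc a + (b + c) ≡ suc b + (a + c)
    ring = solve-∀
  edgeCount-insertColumn (y ∷ G) j (false ∷ c) = trans
    (cong₂ _+_ (size-insertAt y j false) (edgeCount-insertColumn G j c)) (ring (size y) (size c) (edgeCount G))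
    where
    ring : ∀ a b c → a + (b + c) ≡ b + (a + c)
    ring = solve-∀

  adj : ∀ {r s} → BipartiteGraph r s → Fin r → Fin s → Bool
  adj G i j = lookup (lookup G i) j

  SpannedBy : ∀ {r s} → Subset r → Subset s → BipartiteGraph r s → Set
  SpannedBy A B G = Spanned (lookup A) (lookup B) (adj G)

  module _ {r s : ℕ} (i : Fin (suc r)) (x : Subset s) (A : Subset r) (B : Subset s) (G : BipartiteGraph r s) where

    private
      rest : ∀ k j → adj (insertAt G i x) (punchIn i k) j ≡ adj G k j
      rest k j = cong (λ row → lookup row j) (insertAt-punchIn G i x k)
      new : ∀ j → lookup (B ∪ x) j ≡ lookup B j ∨ adj (insertAt G i x) i j
      new j = trans (lookup-zipWith _∨_ j B x) (cong (λ row → lookup B j ∨ lookup row j) (sym (insertAt-lookup G i x)))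

    removeRow : SpannedBy (insertAt A i true) B (insertAt G i x) → SpannedBy A (B ∪ x) G
    removeRow = Spanned-remove i (insertAt-lookup A i true) (insertAt-punchIn A i true) rest new

    insertRow : SpannedBy A (B ∪ x) G → SpannedBy (insertAt A i true) B (insertAt G i x)
    insertRow = Spanned-insert i (insertAt-lookup A i true) (insertAt-punchIn A i true) rest new

  module _ {r s : ℕ} (j : Fin (suc s)) (c : Subset r) (A : Subset r) (B : Subset s) (G : BipartiteGraph r s) where

    private
      row : ∀ i → lookup (insertColumn j c G) i ≡ insertAt (lookup G i) j (lookup c i)
      row i = lookup-zipWith (λ x y → insertAt y j x) i c G
      rest : ∀ k i → adj (insertColumn j c G) i (punchIn j k) ≡ adj G i k
      rest k i = trans (cong (λ v → lookup v (punchIn j k)) (row i)) (insertAt-punchIn (lookup G i) j (lookup c i) k)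
      new : ∀ i → lookup (A ∪ c) i ≡ lookup A i ∨ adj (insertColumn j c G) i j
      new i = trans (lookup-zipWith _∨_ i A c)
        (cong (lookup A i ∨_) (sym (trans (cong (λ v → lookup v j) (row i)) (insertAt-lookup (lookup G i) j (lookup c i)))))

    removeColumn : SpannedBy A (insertAt B j true) (insertColumn j c G) → SpannedBy (A ∪ c) B G
    removeColumn sp = Spanned-flip {A = lookup B} {lookup (A ∪ c)} {flip (adj G)}
      (Spanned-remove j (insertAt-lookup B j true) (insertAt-punchIn B j true) rest new
        (Spanned-flip {A = lookup A} {lookup (insertAt B j true)} {adj (insertColumn j c G)} sp))

    insertColumn⁺ : SpannedBy (A ∪ c) B G → SpannedBy A (insertAt B j true) (insertColumn j c G)
    insertColumn⁺ sp = Spanned-flip {A = lookup (insertAt B j true)} {lookup A} {flip (adj (insertColumn j c G))}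
      (Spanned-insert j (insertAt-lookup B j true) (insertAt-punchIn B j true) rest new
        (Spanned-flip {A = lookup (A ∪ c)} {lookup B} {adj G} sp))

  -- The decision procedure is arbitrary because the one for the smaller graph is transported along
  -- the deletion lemmas.
  ∑-spanned : ∀ n {r s} (A : Subset r) (B : Subset s) φ (spanned? : ∀ G → Dec (SpannedBy A B G)) → n ≡ r + s →
    ∑ (allGraphs r s) (λ G → ind (spanned? G) * φ (edgeCount G)) ≡
    spannedCount n (cosize A) (cosize B) (size A) (size B) φ
  ∑-spanned zero {zero} {zero} [] [] φ spanned? refl =
    trans (+-identityʳ _) (trans (cong (_* φ 0) (ind-cong {Q = SpannedBy [] [] []} id id (spanned? []) (yes λ _ _ _ _ _ → (λ ()) , λ ()))) (*-identityˡ (φ 0)))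
  ∑-spanned (suc n) {r} {s} A B φ spanned? eq with (size A) in eqA | (size B) in eqB
  ... | zero | zero = trans (∑-cong (allGraphs r s) λ G → cong (_* φ (edgeCount G)) (ind-no (unspanned G) (spanned? G)))
                            (∑-0 (allGraphs r s))
    where
    vertex : ∀ {r s} → suc n ≡ r + s → ¬ ((Fin r → false ≡ true) × (Fin s → false ≡ true))
    vertex {suc r} {s}     eq (p , q) with () ← p zero
    vertex {zero}  {suc s} eq (p , q) with () ← q zero
    unspanned : ∀ G → ¬ SpannedBy A B G
    -- Without marks the empty pair is closed, yet it misses a vertex, of which there is at least
    -- one.
    unspanned G sp = vertex eq (sp (λ _ → false) (λ _ → false)
      (λ i Ai → contradiction Ai (unmarked A eqA i)) (λ j Bj → contradiction Bj (unmarked B eqB j)) λ _ _ _ → refl)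
  ... | suc a | b with findMarked A eqA
  ...   | marked {r′} A′ i = begin
    ∑ (allGraphs (suc r′) s) (λ G → ind (spanned? G) * φ (edgeCount G))
      ≡⟨ ∑-insertAt (allSubsets s) i (λ G → ind (spanned? G) * φ (edgeCount G)) ⟩
    ∑ (allSubsets s) (λ x → ∑ (allGraphs r′ s) (λ G → ind (spanned? (insertAt G i x)) * φ (edgeCount (insertAt G i x))))
      ≡⟨ ∑-cong (allSubsets s) (λ x → trans
           (∑-cong (allGraphs r′ s) λ G → cong₂ _*_
             (ind-cong (removeRow i x A′ B G) (insertRow i x A′ B G) (spanned? (insertAt G i x)) (spanned?′ x G))
             (cong φ (edgeCount-insertAt G i x)))
           (∑-spanned n A′ (B ∪ x) (λ e → φ ((size x) + e)) (spanned?′ x) (suc-injective eq))) ⟩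
    ∑ (allSubsets s) (λ x → f (size x) (cosize (B ∪ x)) (size (B ∪ x)))
      ≡⟨ ∑-∪ B f ⟩
    split (size B) (λ i _ → split (cosize B) (λ j s′ → f (i + j) s′ ((size B) + j)))
      ≡⟨ cong (λ b → split b (λ i _ → split (cosize B) (λ j s′ → f (i + j) s′ (b + j)))) eqB ⟩
    split b (λ i _ → split (cosize B) (λ j s′ → f (i + j) s′ (b + j)))
      ≡⟨ cong₂ (λ r a → spannedCount (suc n) r (cosize B) (suc a) b φ) (cosize-insertAt A′ i)
           (suc-injective (trans (sym eqA) (size-insertAt A′ i true))) ⟨
    spannedCount (suc n) (cosize (insertAt A′ i true)) (cosize B) (suc a) b φ ∎
    where
    open ≡-Reasoning
    spanned?′ : ∀ x G → Dec (SpannedBy A′ (B ∪ x) G)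
    spanned?′ x G = map′ (removeRow i x A′ B G) (insertRow i x A′ B G) (spanned? (insertAt G i x))
    f : ℕ → ℕ → ℕ → ℕ
    f e u t = spannedCount n (cosize A′) u (size A′) t (λ e′ → φ (e + e′))
  ∑-spanned (suc n) {r} {s} A B φ spanned? eq | zero | suc b with findMarked B eqB
  ...   | marked {s′} B′ j = begin
    ∑ (allGraphs r (suc s′)) (λ G → ind (spanned? G) * φ (edgeCount G))
      ≡⟨ ∑-insertColumn r j (λ G → ind (spanned? G) * φ (edgeCount G)) ⟩
    ∑ (allSubsets r) (λ x → ∑ (allGraphs r s′) (λ G → ind (spanned? (insertColumn j x G)) * φ (edgeCount (insertColumn j x G))))
      ≡⟨ ∑-cong (allSubsets r) (λ x → trans
           (∑-cong (allGraphs r s′) λ G → cong₂ _*_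
             (ind-cong (removeColumn j x A B′ G) (insertColumn⁺ j x A B′ G) (spanned? (insertColumn j x G)) (spanned?′ x G))
             (cong φ (edgeCount-insertColumn G j x)))
           (∑-spanned n (A ∪ x) B′ (λ e → φ ((size x) + e)) (spanned?′ x) (suc-injective (trans eq (+-suc r s′))))) ⟩
    ∑ (allSubsets r) (λ x → f (size x) (cosize (A ∪ x)) (size (A ∪ x)))
      ≡⟨ ∑-∪ A f ⟩
    split (size A) (λ i _ → split (cosize A) (λ j r′ → f (i + j) r′ ((size A) + j)))
      ≡⟨ cong (λ a → split a (λ i _ → split (cosize A) (λ j r′ → f (i + j) r′ (a + j)))) eqA ⟩
    -- No row is marked here, so the sum over `i` has collapsed by computation to `i = 0`.
    split (cosize A) (λ j r′ → f j r′ j)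
      ≡⟨ cong₂ (λ s b → spannedCount (suc n) (cosize A) s zero (suc b) φ) (cosize-insertAt B′ j)
           (suc-injective (trans (sym eqB) (size-insertAt B′ j true))) ⟨
    spannedCount (suc n) (cosize A) (cosize (insertAt B′ j true)) zero (suc b) φ ∎
    where
    open ≡-Reasoning
    spanned?′ : ∀ x G → Dec (SpannedBy (A ∪ x) B′ G)
    spanned?′ x G = map′ (removeColumn j x A B′ G) (insertColumn⁺ j x A B′ G) (spanned? (insertColumn j x G))
    f : ℕ → ℕ → ℕ → ℕ
    f e u t = spannedCount n u (cosize B′) t (size B′) (λ e′ → φ (e + e′))

  -- Connected graphs as graphs explored from one vertex

  from-does : ∀ {P : Set} (p? : Dec P) → does p? ≡ true → P
  from-does (yes p) _ = p

  module _ {r s : ℕ} (G : BipartiteGraph r s) where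

    open Reachability (Adjacent G) (Sum.≡-dec Fin._≟_ Fin._≟_) (adjacent? G) allVertices ∈-allVertices using (star?)

    Adjacent-sym : ∀ {u v} → Adjacent G u v → Adjacent G v u
    Adjacent-sym {inj₁ _} {inj₂ _} e = e
    Adjacent-sym {inj₂ _} {inj₁ _} e = e

    module _ (X : Fin r → Bool) (Y : Fin s → Bool) (closed : ∀ i j → adj G i j ≡ true → X i ≡ Y j) where

      closed-step : ∀ {u v} → Adjacent G u v → [ X , Y ]′ u ≡ [ X , Y ]′ v
      closed-step {inj₁ i} {inj₂ j} e = closed i j ([]=⇒lookup e)
      closed-step {inj₂ j} {inj₁ i} e = sym (closed i j ([]=⇒lookup e))

      closed-star : ∀ {u v} → Star (Adjacent G) u v → [ X , Y ]′ u ≡ [ X , Y ]′ v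
      closed-star ε        = refl
      closed-star (e ◅ es) = trans (closed-step e) (closed-star es)

    module _ (A : Subset r) (B : Subset s) (root : Vertex r s) where

      Connected⇒Spanned : [ lookup A , lookup B ]′ root ≡ true → Connected G → SpannedBy A B G
      Connected⇒Spanned root∈ connected X Y A⊆X B⊆Y closed =
        (λ i → reached (inj₁ i)) , (λ j → reached (inj₂ j))
        where
        root-reached : ∀ v → [ lookup A , lookup B ]′ v ≡ true → [ X , Y ]′ v ≡ true
        root-reached (inj₁ i) = A⊆X i
        root-reached (inj₂ j) = B⊆Y j
        reached : ∀ v → [ X , Y ]′ v ≡ true
        reached v = trans (sym (closed-star X Y closed (connected root v))) (root-reached root root∈)

      -- The vertices reachable from the root form a closed pair, hence are all vertices. `Spanned`
      -- speaks of Boolean sets, so reachability has to be decided.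
      Spanned⇒Connected : (∀ v → [ lookup A , lookup B ]′ v ≡ true → v ≡ root) → SpannedBy A B G → Connected G
      Spanned⇒Connected only-root spanned u v = reverse Adjacent-sym (path u) ◅◅ path v
        where
        X : Fin r → Bool
        X i = does (star? root (inj₁ i))
        Y : Fin s → Bool
        Y j = does (star? root (inj₂ j))
        start : ∀ v → [ lookup A , lookup B ]′ v ≡ true → does (star? root v) ≡ true
        start v v∈ with refl ← only-root v v∈ = dec-true (star? root root) ε
        closed : ∀ i j → adj G i j ≡ true → X i ≡ Y j
        closed i j eq = does-⇔ (mk⇔ (_◅◅ (e ◅ ε)) (_◅◅ (e ◅ ε))) (star? root (inj₁ i)) (star? root (inj₂ j))
          where e = lookup⇒[]= j (lookup G i) eq
        all = spanned X Y (λ i → start (inj₁ i)) (λ j → start (inj₂ j)) closed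
        path : ∀ v → Star (Adjacent G) root v
        path (inj₁ i) = from-does (star? root (inj₁ i)) (proj₁ all i)
        path (inj₂ j) = from-does (star? root (inj₂ j)) (proj₂ all j)

  none : ∀ n → Subset n
  none n = replicate n false

  size-none : ∀ n → size (none n) ≡ 0
  size-none zero    = refl
  size-none (suc n) = size-none n

  cosize-none : ∀ n → cosize (none n) ≡ n
  cosize-none zero    = refl
  cosize-none (suc n) = cong suc (cosize-none n)

  none∌ : ∀ {n} i → lookup (none n) i ≢ true
  none∌ {n} i eq with () ← trans (sym (lookup-replicate i false)) eq

  first : ∀ n → Subset (suc n)
  first n = true ∷ none n

  exactly : ℕ → ℕ → ℕ
  exactly n e = ind (e ≟ n)

  -- A connected graph with Betti number 2 on m + 1 vertices has m + 2 edges.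
  bicyclicCount : (m r s a b : ℕ) → ℕ
  bicyclicCount m r s a b = spannedCount (suc m) r s a b (exactly (2 + m))

  module _ (r s : ℕ) (A : Subset (suc r)) (B : Subset (suc s)) (root : Vertex (suc r) (suc s))
    (root∈ : [ lookup A , lookup B ]′ root ≡ true)
    (only-root : ∀ v → [ lookup A , lookup B ]′ v ≡ true → v ≡ root) where

    N-bi-rooted : N-bi (suc r) (suc s) (ℤ.+ 2) ≡ bicyclicCount (r + suc s) (cosize A) (cosize B) (size A) (size B)
    N-bi-rooted = begin
      N-bi (suc r) (suc s) (ℤ.+ 2)
        ≡⟨ length-filter (connectedWithBetti? (ℤ.+ 2)) (allGraphs (suc r) (suc s)) ⟩
      ∑ (allGraphs (suc r) (suc s)) (λ G → ind (connectedWithBetti? (ℤ.+ 2) G))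
        ≡⟨ ∑-cong (allGraphs (suc r) (suc s)) (λ G → trans (ind-× (connected? G) _)
             (cong₂ _*_
               (ind-cong (Connected⇒Spanned G A B root root∈) (Spanned⇒Connected G A B root only-root) (connected? G) (spanned? G))
               (ind-cong (λ eq → trans (ℤ.+-injective eq) size-eq) (λ eq → cong ℤ.+_ (trans eq (sym size-eq)))
                 _ (edgeCount G ≟ 2 + (r + suc s))))) ⟩
      ∑ (allGraphs (suc r) (suc s)) (λ G → ind (spanned? G) * exactly (2 + (r + suc s)) (edgeCount G))
        ≡⟨ ∑-spanned (suc (r + suc s)) A B (exactly (2 + (r + suc s))) spanned? refl ⟩
      bicyclicCount (r + suc s) (cosize A) (cosize B) (size A) (size B) ∎
      where
      open ≡-Reasoning
      spanned? : ∀ G → Dec (SpannedBy A B G)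
      spanned? G = map′ (Connected⇒Spanned G A B root root∈) (Spanned⇒Connected G A B root only-root) (connected? G)
      size-eq : r + suc s + 2 ≡ 2 + (r + suc s)
      size-eq = +-comm (r + suc s) 2

  -- The root is the first row. Without columns both sides vanish, in accordance with the convention
  -- for `N-bi`.
  N-bi-rowRooted : ∀ r s → N-bi (suc r) s (ℤ.+ 2) ≡ bicyclicCount (r + s) r s 1 0
  N-bi-rowRooted zero    zero    = refl
  N-bi-rowRooted (suc r) zero    = refl
  N-bi-rowRooted r₀      (suc s₀) = trans
    (N-bi-rooted r₀ s₀ (first r₀) (none (suc s₀)) (inj₁ zero) refl only)
    (cong₂ (λ (r , s) (a , b) → bicyclicCount (r₀ + suc s₀) r s (suc a) b) (cong₂ _,_ (cosize-none r₀) (cosize-none (suc s₀)))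
      (cong₂ _,_ (size-none r₀) (size-none (suc s₀))))
    where
    only : ∀ v → [ lookup (first r₀) , lookup (none (suc s₀)) ]′ v ≡ true → v ≡ inj₁ zero
    only (inj₁ zero)    _  = refl
    only (inj₁ (suc i)) eq = contradiction eq (none∌ i)
    only (inj₂ j)       eq = contradiction eq (none∌ j)

  N-bi-columnRooted : ∀ r s → N-bi r (suc s) (ℤ.+ 2) ≡ bicyclicCount (r + s) r s 0 1
  N-bi-columnRooted zero    zero    = refl
  N-bi-columnRooted zero    (suc s) = refl
  N-bi-columnRooted (suc r₀) s₀ = trans
    (N-bi-rooted r₀ s₀ (none (suc r₀)) (first s₀) (inj₂ zero) refl only)
    (trans
      (cong₂ (λ (r , s) (a , b) → bicyclicCount (r₀ + suc s₀) r s a (suc b))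
        (cong₂ _,_ (cosize-none (suc r₀)) (cosize-none s₀)) (cong₂ _,_ (size-none (suc r₀)) (size-none s₀)))
      (cong (λ m → bicyclicCount m (suc r₀) s₀ 0 1) (+-suc r₀ s₀)))
    where
    only : ∀ v → [ lookup (none (suc r₀)) , lookup (first s₀) ]′ v ≡ true → v ≡ inj₂ zero
    only (inj₂ zero)    _  = refl
    only (inj₂ (suc i)) eq = contradiction eq (none∌ i)
    only (inj₁ j)       eq = contradiction eq (none∌ j)

  -- One Pascal step of `split` decides the side of a distinguished vertex, which becomes the root;
  -- the other `m` vertices remain to be distributed.
  N-bi-total≡split : ∀ m → N-bi-total (suc m) (ℤ.+ 2) ≡
    split m (λ r s → bicyclicCount m r s 1 0) + split m (λ r s → bicyclicCount m r s 0 1)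
  N-bi-total≡split m = begin
    N-bi-total (suc m) (ℤ.+ 2)
      ≡⟨ cong sum (List.map-applyUpTo id (λ r → (suc m choose r) * N-bi r (suc m ∸ r) (ℤ.+ 2)) (2 + m)) ⟩
    binomialSum (suc m) (λ r s → N-bi r s (ℤ.+ 2))
      ≡⟨ binomialSum≡split (suc m) (λ r s → N-bi r s (ℤ.+ 2)) ⟩
    split m (λ r s → N-bi (suc r) s (ℤ.+ 2)) + split m (λ r s → N-bi r (suc s) (ℤ.+ 2))
      ≡⟨ cong₂ _+_ (split-cong m λ r s eq → trans (N-bi-rowRooted r s) (cong (λ m → bicyclicCount m r s 1 0) eq))
                   (split-cong m λ r s eq → trans (N-bi-columnRooted r s) (cong (λ m → bicyclicCount m r s 0 1) eq)) ⟩
    split m (λ r s → bicyclicCount m r s 1 0) + split m (λ r s → bicyclicCount m r s 0 1) ∎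
    where open ≡-Reasoning

  -- Power series in the tree function

  -- Power series in T, with the coefficients of even (false) and odd (true) powers listed separately.
  Series : Set
  Series = Bool → ℕ → ℕ

  infix 4 _≗ˢ_
  _≗ˢ_ : Series → Series → Set
  h ≗ˢ h′ = ∀ p i → h p i ≡ h′ p i

  tail : Series → Series
  tail h false i = h true i
  tail h true  i = h false (suc i)

  -- Multiplication by T.
  S : Series → Series
  S h false zero    = 0
  S h false (suc i) = h true i
  S h true  i       = h false i

  S^ : ℕ → Series → Series
  S^ zero    h = h
  S^ (suc n) h = S (S^ n h)

  tail-S : ∀ h → tail (S h) ≗ˢ h
  tail-S h false i = refl
  tail-S h true  i = refl

  -- m! [x^m] exp(cT), where T = x exp(T): the forests on m + c vertices rooted at c given ones.
  forests : ℕ → ℕ → ℕ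
  forests zero    c = 1
  forests (suc m) c = c * (suc m + c) ^ m

  -- m! [x^m] h(T) exp(cT), using T exp(cT) = x exp((c+1)T).
  Φ : ℕ → ℕ → Series → ℕ
  Φ zero    c h = h false 0
  Φ (suc m) c h = h false 0 * forests (suc m) c + suc m * Φ m (suc c) (tail h)

  Φ-cong : ∀ m c {h h′} → h ≗ˢ h′ → Φ m c h ≡ Φ m c h′
  Φ-cong zero    c eq = eq false 0
  Φ-cong (suc m) c {h} {h′} eq = cong₂ (λ x y → x * forests (suc m) c + suc m * y) (eq false 0)
    (Φ-cong m (suc c) tail-eq)
    where
    tail-eq : tail h ≗ˢ tail h′
    tail-eq false i = eq true i
    tail-eq true  i = eq false (suc i)

  Φ-+ : ∀ m c h h′ → Φ m c (λ p i → h p i + h′ p i) ≡ Φ m c h + Φ m c h′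
  Φ-+ zero    c h h′ = refl
  Φ-+ (suc m) c h h′ = begin
    (h false 0 + h′ false 0) * f + suc m * Φ m (suc c) (tail (λ p i → h p i + h′ p i))
      ≡⟨ cong (λ y → (h false 0 + h′ false 0) * f + suc m * y)
           (trans (Φ-cong m (suc c) λ { false i → refl ; true i → refl }) (Φ-+ m (suc c) (tail h) (tail h′))) ⟩
    (h false 0 + h′ false 0) * f + suc m * (Φ m (suc c) (tail h) + Φ m (suc c) (tail h′))
      ≡⟨ ring (h false 0) (h′ false 0) f m (Φ m (suc c) (tail h)) (Φ m (suc c) (tail h′)) ⟩
    Φ (suc m) c h + Φ (suc m) c h′ ∎
    where
    open ≡-Reasoning
    f = forests (suc m) c
    ring : ∀ x y f m u v → (x + y) * f + suc m * (u + v) ≡ (x * f + suc m * u) + (y * f + suc m * v)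
    ring = solve-∀

  Φ-* : ∀ m c k h → Φ m c (λ p i → k * h p i) ≡ k * Φ m c h
  Φ-* zero    c k h = refl
  Φ-* (suc m) c k h = begin
    k * h false 0 * f + suc m * Φ m (suc c) (tail (λ p i → k * h p i))
      ≡⟨ cong (λ y → k * h false 0 * f + suc m * y)
           (trans (Φ-cong m (suc c) λ { false i → refl ; true i → refl }) (Φ-* m (suc c) k (tail h))) ⟩
    k * h false 0 * f + suc m * (k * Φ m (suc c) (tail h))
      ≡⟨ ring k (h false 0) f m (Φ m (suc c) (tail h)) ⟩
    k * Φ (suc m) c h ∎
    where
    open ≡-Reasoning
    f = forests (suc m) c
    ring : ∀ k x f m u → k * x * f + suc m * (k * u) ≡ k * (x * f + suc m * u)
    ring = solve-∀

  Φ-S : ∀ m c h → Φ (suc m) c (S h) ≡ suc m * Φ m (suc c) h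
  Φ-S m c h = cong (suc m *_) (Φ-cong m (suc c) (tail-S h))

  split-^ : ∀ N m → split m (λ _ j → N ^ j) ≡ suc N ^ m
  split-^ N zero    = refl
  split-^ N (suc m) = trans (cong (split m (λ _ j → N ^ j) +_) (split-* m N _))
    (cong (λ x → x + N * x) (split-^ N m))

  -- Delete one of the `suc c` roots of a forest: its `j` children become roots beside the other
  -- `c`. Algebraically this is the binomial theorem, as all terms share the base `N`.
  split-forests : ∀ m c → split m (λ j m′ → forests m′ (c + j)) ≡ forests m (suc c)
  split-forests zero    c = refl
  -- The factor `N` raises the exponent m′ - 1 of `forests` to m′, which makes sense for m′ = 0 too.
  split-forests (suc n) c = *-cancelˡ-≡ _ _ N (begin
    N * split (suc n) (λ j m′ → forests m′ (c + j))
      ≡⟨ split-* (suc n) N (λ j m′ → forests m′ (c + j)) ⟨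
    split (suc n) (λ j m′ → N * forests m′ (c + j))
      ≡⟨ split-cong (suc n) term ⟩
    split (suc n) (λ j m′ → c * N ^ m′ + j * N ^ m′)
      ≡⟨ split-+ (suc n) (λ _ m′ → c * N ^ m′) (λ j m′ → j * N ^ m′) ⟩
    split (suc n) (λ _ m′ → c * N ^ m′) + split (suc n) (λ j m′ → j * N ^ m′)
      ≡⟨ cong₂ _+_ (trans (split-* (suc n) c (λ _ m′ → N ^ m′)) (cong (c *_) (split-^ N (suc n))))
           (trans (split-absorbˡ n (λ _ m′ → N ^ m′)) (cong (suc n *_) (split-^ N n))) ⟩
    c * (suc N * suc N ^ n) + suc n * suc N ^ n
      ≡⟨ ring c n (suc N ^ n) ⟩
    N * (suc c * suc N ^ n)
      ≡⟨ cong (λ M → N * (suc c * M ^ n)) (+-suc (suc n) c) ⟨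
    N * forests (suc n) (suc c) ∎)
    where
    open ≡-Reasoning
    N = suc n + c
    ring : ∀ c n x → c * (suc (suc n + c) * x) + suc n * x ≡ (suc n + c) * (suc c * x)
    ring = solve-∀
    total : ∀ j m′ → j + m′ ≡ suc n → m′ + (c + j) ≡ N
    total j m′ eq = trans (ring′ m′ c j) (cong (_+ c) eq)
      where
      ring′ : ∀ m′ c j → m′ + (c + j) ≡ j + m′ + c
      ring′ = solve-∀
    term : ∀ j m′ → j + m′ ≡ suc n → N * forests m′ (c + j) ≡ c * N ^ m′ + j * N ^ m′
    term j zero     eq = trans (cong (_* 1) (sym (total j zero eq))) (*-distribʳ-+ 1 c j)
    term j (suc m′) eq = trans (cong (λ M → N * ((c + j) * M ^ m′)) (total j (suc m′) eq)) (ring′ N c j (N ^ m′))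
      where
      ring′ : ∀ N c j x → N * ((c + j) * x) ≡ c * (N * x) + j * (N * x)
      ring′ = solve-∀

  -- The recursion without case distinction: for `m = 0` the factor `m` discards the meaningless
  -- `pred m`.
  Φ-unfold : ∀ m c h → Φ m c h ≡ h false 0 * forests m c + m * Φ (pred m) (suc c) (tail h)
  Φ-unfold zero    c h = sym (trans (+-identityʳ _) (*-identityʳ _))
  Φ-unfold (suc m) c h = refl

  -- In generating functions, the sum of x^j/j! exp((c+j)T) over j is exp(cT + x exp(T)) =
  -- exp((c+1)T).
  split-Φ : ∀ m c h → split m (λ j m′ → Φ m′ (c + j) h) ≡ Φ m (suc c) h
  split-Φ zero    c h = refl
  split-Φ (suc n) c h = begin
    split (suc n) (λ j m′ → Φ m′ (c + j) h)
      ≡⟨ split-cong (suc n) (λ j m′ _ → Φ-unfold m′ (c + j) h) ⟩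
    split (suc n) (λ j m′ → h false 0 * forests m′ (c + j) + m′ * Φ (pred m′) (suc (c + j)) (tail h))
      ≡⟨ split-+ (suc n) (λ j m′ → h false 0 * forests m′ (c + j)) (λ j m′ → m′ * Φ (pred m′) (suc (c + j)) (tail h)) ⟩
    split (suc n) (λ j m′ → h false 0 * forests m′ (c + j))
      + split (suc n) (λ j m′ → m′ * Φ (pred m′) (suc (c + j)) (tail h))
      ≡⟨ cong₂ _+_ (trans (split-* (suc n) (h false 0) (λ j m′ → forests m′ (c + j))) (cong (h false 0 *_) (split-forests (suc n) c)))
           (trans (split-absorbʳ n (λ j m′ → Φ m′ (suc (c + j)) (tail h)))
             (cong (suc n *_) (split-Φ n (suc c) (tail h)))) ⟩
    Φ (suc n) (suc c) h ∎
    where open ≡-Reasoning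

  -- Falling factorials and Poisson moments

  fall : ℕ → ℕ → ℕ
  fall n       zero    = 1
  fall zero    (suc q) = 0
  fall (suc n) (suc q) = suc n * fall n q

  fall-pascal : ∀ n q → fall (suc n) (suc q) ≡ fall n (suc q) + suc q * fall n q
  fall-pascal zero    zero    = refl
  fall-pascal zero    (suc q) = sym (*-zeroʳ (2 + q))
  fall-pascal (suc n) zero    = ring n
    where
    ring : ∀ n → suc (suc n) * 1 ≡ suc n * 1 + 1 * 1
    ring = solve-∀
  fall-pascal (suc n) (suc q) = begin
    suc (suc n) * fall (suc n) (suc q)               ≡⟨ cong (suc (suc n) *_) (fall-pascal n q) ⟩
    suc (suc n) * (fall n (suc q) + suc q * fall n q) ≡⟨ ring n q (fall n (suc q)) (fall n q) (fall-pascal n q) ⟩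
    suc n * fall n (suc q) + suc (suc q) * (suc n * fall n q) ∎
    where
    open ≡-Reasoning
    ring′ : ∀ n q x y → suc (suc n) * (x + suc q * y) ≡ suc n * (x + suc q * y) + (x + suc q * y)
    ring′ = solve-∀
    ring″ : ∀ n q x y → suc n * (x + suc q * y) + suc n * y ≡ suc n * x + suc (suc q) * (suc n * y)
    ring″ = solve-∀
    ring : ∀ n q x y → suc n * y ≡ x + suc q * y → suc (suc n) * (x + suc q * y) ≡ suc n * x + suc (suc q) * (suc n * y)
    ring n q x y eq = trans (ring′ n q x y) (trans (cong (suc n * (x + suc q * y) +_) (sym eq)) (ring″ n q x y))

  -- The factorial moments of a Poisson variable of mean T are the powers of T.
  split-fall-Φ : ∀ i m c h → split m (λ j m′ → fall j i * Φ m′ (c + j) h) ≡ Φ m (suc c) (S^ i h)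
  split-fall-Φ zero    m c h = trans (split-cong m λ j m′ _ → *-identityˡ _) (split-Φ m c h)
  split-fall-Φ (suc i) zero    c h = refl
  split-fall-Φ (suc i) (suc n) c h = begin
    split (suc n) (λ j m′ → fall j (suc i) * Φ m′ (c + j) h)
      ≡⟨ split-cong (suc n) term ⟩
    split (suc n) (λ j m′ → j * (fall (pred j) i * Φ m′ (suc c + pred j) h))
      ≡⟨ split-absorbˡ n (λ j m′ → fall j i * Φ m′ (suc c + j) h) ⟩
    suc n * split n (λ j m′ → fall j i * Φ m′ (suc c + j) h)
      ≡⟨ cong (suc n *_) (split-fall-Φ i n (suc c) h) ⟩
    suc n * Φ n (2 + c) (S^ i h)
      ≡⟨ Φ-S n (suc c) (S^ i h) ⟨
    Φ (suc n) (suc c) (S^ (suc i) h) ∎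
    where
    open ≡-Reasoning
    term : ∀ j m′ → j + m′ ≡ suc n →
      fall j (suc i) * Φ m′ (c + j) h ≡ j * (fall (pred j) i * Φ m′ (suc c + pred j) h)
    term zero    m′ _ = refl
    term (suc j) m′ _ = trans (*-assoc (suc j) (fall j i) _)
      (cong (λ k → suc j * (fall j i * Φ m′ k h)) (+-suc c j))

  -- The series h times the q-th factorial moment of b + J, where J is Poisson of mean T.
  shifted : ℕ → ℕ → Series → Series
  shifted zero    q       h = S^ q h
  shifted (suc b) zero    h = h
  shifted (suc b) (suc q) h = λ p i → shifted b (suc q) h p i + suc q * shifted b q h p i

  split-shifted : ∀ b q m c h → split m (λ j m′ → fall (b + j) q * Φ m′ (c + j) h) ≡ Φ m (suc c) (shifted b q h)
  split-shifted zero    q       m c h = split-fall-Φ q m c h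
  split-shifted (suc b) zero    m c h = split-fall-Φ 0 m c h
  split-shifted (suc b) (suc q) m c h = begin
    split m (λ j m′ → fall (suc (b + j)) (suc q) * Φ m′ (c + j) h)
      ≡⟨ split-cong m (λ j m′ _ → trans (cong (_* Φ m′ (c + j) h) (fall-pascal (b + j) q))
           (ring (fall (b + j) (suc q)) q (fall (b + j) q) (Φ m′ (c + j) h))) ⟩
    split m (λ j m′ → fall (b + j) (suc q) * Φ m′ (c + j) h + suc q * (fall (b + j) q * Φ m′ (c + j) h))
      ≡⟨ split-+ m _ (λ j m′ → suc q * (fall (b + j) q * Φ m′ (c + j) h)) ⟩
    split m (λ j m′ → fall (b + j) (suc q) * Φ m′ (c + j) h)
      + split m (λ j m′ → suc q * (fall (b + j) q * Φ m′ (c + j) h))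
      ≡⟨ cong₂ _+_ (split-shifted b (suc q) m c h)
           (trans (split-* m (suc q) _) (cong (suc q *_) (split-shifted b q m c h))) ⟩
    Φ m (suc c) (shifted b (suc q) h) + suc q * Φ m (suc c) (shifted b q h)
      ≡⟨ cong (Φ m (suc c) (shifted b (suc q) h) +_) (Φ-* m (suc c) (suc q) (shifted b q h)) ⟨
    Φ m (suc c) (shifted b (suc q) h) + Φ m (suc c) (λ p i → suc q * shifted b q h p i)
      ≡⟨ Φ-+ m (suc c) (shifted b (suc q) h) (λ p i → suc q * shifted b q h p i) ⟨
    Φ m (suc c) (shifted (suc b) (suc q) h) ∎
    where
    open ≡-Reasoning
    ring : ∀ x q y z → (x + suc q * y) * z ≡ x * z + suc q * (y * z)
    ring = solve-∀

  module _ (h : Series) (p : Bool) (i : ℕ) where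

    shifted-0 : ∀ b → shifted b 0 h p i ≡ h p i
    shifted-0 zero    = refl
    shifted-0 (suc b) = refl

    -- This and the next three are Vandermonde's identity for the q-th falling factorial of b + J,
    -- with T^n for the n-th factorial moment of J. Degree 4 is the highest in `g₂`.
    shifted-1 : ∀ b → shifted b 1 h p i ≡ fall b 1 * h p i + S h p i
    shifted-1 zero    = refl
    shifted-1 (suc b) = trans (cong₂ (λ x y → x + 1 * y) (shifted-1 b) (shifted-0 b))
      (trans (ring (fall b 1) (h p i) (S h p i)) (cong (λ f → f * h p i + S h p i) (sym (fall-pascal b 0))))
      where
      ring : ∀ f x y → f * x + y + 1 * x ≡ (f + 1 * 1) * x + y
      ring = solve-∀

    shifted-2 : ∀ b → shifted b 2 h p i ≡ fall b 2 * h p i + 2 * fall b 1 * S h p i + S^ 2 h p i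
    shifted-2 zero    = refl
    shifted-2 (suc b) = trans (cong₂ (λ x y → x + 2 * y) (shifted-2 b) (shifted-1 b))
      (trans (ring (fall b 1) (fall b 2) (h p i) (S h p i) (S^ 2 h p i))
        (cong₂ (λ f g → g * h p i + 2 * f * S h p i + S^ 2 h p i)
           (sym (fall-pascal b 0)) (sym (fall-pascal b 1))))
      where
      ring : ∀ f g x y z → (g * x + 2 * f * y + z) + 2 * (f * x + y) ≡ (g + 2 * f) * x + 2 * (f + 1 * 1) * y + z
      ring = solve-∀

    shifted-3 : ∀ b → shifted b 3 h p i ≡
      fall b 3 * h p i + 3 * fall b 2 * S h p i + 3 * fall b 1 * S^ 2 h p i + S^ 3 h p i
    shifted-3 zero    = refl
    shifted-3 (suc b) = trans (cong₂ (λ x y → x + 3 * y) (shifted-3 b) (shifted-2 b))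
      (trans (ring (fall b 1) (fall b 2) (fall b 3) (h p i) (S h p i) (S^ 2 h p i) (S^ 3 h p i))
        (trans (cong₂ (λ f g → (fall b 3 + 3 * fall b 2) * h p i + 3 * g * S h p i + 3 * f * S^ 2 h p i + S^ 3 h p i)
           (sym (fall-pascal b 0)) (sym (fall-pascal b 1)))
          (cong (λ k → k * h p i + 3 * fall (suc b) 2 * S h p i + 3 * fall (suc b) 1 * S^ 2 h p i + S^ 3 h p i)
           (sym (fall-pascal b 2)))))
      where
      ring : ∀ f g k x y z w → (k * x + 3 * g * y + 3 * f * z + w) + 3 * (g * x + 2 * f * y + z)
        ≡ (k + 3 * g) * x + 3 * (g + 2 * f) * y + 3 * (f + 1 * 1) * z + w
      ring = solve-∀

    shifted-4 : ∀ b → shifted b 4 h p i ≡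
      fall b 4 * h p i + 4 * fall b 3 * S h p i + 6 * fall b 2 * S^ 2 h p i + 4 * fall b 1 * S^ 3 h p i + S^ 4 h p i
    shifted-4 zero    = refl
    shifted-4 (suc b) = trans (cong₂ (λ x y → x + 4 * y) (shifted-4 b) (shifted-3 b))
      (trans (ring (fall b 1) (fall b 2) (fall b 3) (fall b 4) (h p i) (S h p i) (S^ 2 h p i) (S^ 3 h p i) (S^ 4 h p i))
        (trans (cong₂ (λ f g → (fall b 4 + 4 * fall b 3) * h p i + 4 * (fall b 3 + 3 * fall b 2) * S h p i
                                + 6 * g * S^ 2 h p i + 4 * f * S^ 3 h p i + S^ 4 h p i)
           (sym (fall-pascal b 0)) (sym (fall-pascal b 1)))
          (cong₂ (λ k l → l * h p i + 4 * k * S h p i + 6 * fall (suc b) 2 * S^ 2 h p i + 4 * fall (suc b) 1 * S^ 3 h p i + S^ 4 h p i)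
           (sym (fall-pascal b 2)) (sym (fall-pascal b 3)))))
      where
      ring : ∀ f g k l x y z w v →
        (l * x + 4 * k * y + 6 * g * z + 4 * f * w + v) + 4 * (k * x + 3 * g * y + 3 * f * z + w)
        ≡ (l + 4 * k) * x + 4 * (k + 3 * g) * y + 6 * (g + 2 * f) * z + 4 * (f + 1 * 1) * w + v
      ring = solve-∀

  -- Eventually polynomial coefficient sequences

  infixr 5 _⊞ₚ_ _⊞ₛ_ _⊞_ _▹_

  _⊞ₚ_ : List ℕ → List ℕ → List ℕ
  []      ⊞ₚ q       = q
  (c ∷ p) ⊞ₚ []      = c ∷ p
  (c ∷ p) ⊞ₚ (d ∷ q) = c + d ∷ p ⊞ₚ q

  eval : List ℕ → ℕ → ℕ
  eval []      i = 0
  eval (c ∷ p) i = c + i * eval p i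

  eval-⊞ₚ : ∀ p q i → eval (p ⊞ₚ q) i ≡ eval p i + eval q i
  eval-⊞ₚ []      q       i = refl
  eval-⊞ₚ (c ∷ p) []      i = sym (+-identityʳ _)
  eval-⊞ₚ (c ∷ p) (d ∷ q) i = trans (cong (λ x → c + d + i * x) (eval-⊞ₚ p q i)) (ring c d i (eval p i) (eval q i))
    where
    ring : ∀ c d i x y → c + d + i * (x + y) ≡ c + i * x + (d + i * y)
    ring = solve-∀

  translate : List ℕ → List ℕ
  translate []      = []
  translate (c ∷ p) = (c ∷ translate p) ⊞ₚ translate p

  eval-translate : ∀ p i → eval (translate p) i ≡ eval p (suc i)
  eval-translate []      i = refl
  eval-translate (c ∷ p) i = trans (eval-⊞ₚ (c ∷ translate p) (translate p) i)
    (trans (cong (λ x → c + i * x + x) (eval-translate p i)) (ring c i (eval p (suc i))))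
    where
    ring : ∀ c i x → c + i * x + x ≡ c + suc i * x
    ring = solve-∀

  -- The polynomial takes the index counted from the end of the prefix. So multiplication by T
  -- merely prepends 0, and values such as i - 1 for i ≥ 1 need no negative coefficients.
  data Seq : Set where
    poly : List ℕ → Seq
    _▹_  : ℕ → Seq → Seq

  at : Seq → ℕ → ℕ
  at (poly p) i       = eval p i
  at (c ▹ s)  zero    = c
  at (c ▹ s)  (suc i) = at s i

  _⊞ₛ_ : List ℕ → Seq → Seq
  p ⊞ₛ poly q  = poly (p ⊞ₚ q)
  p ⊞ₛ (d ▹ t) = eval p 0 + d ▹ translate p ⊞ₛ t

  at-⊞ₛ : ∀ p t i → at (p ⊞ₛ t) i ≡ eval p i + at t i
  at-⊞ₛ p (poly q) i       = eval-⊞ₚ p q i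
  at-⊞ₛ p (d ▹ t)  zero    = refl
  at-⊞ₛ p (d ▹ t)  (suc i) = trans (at-⊞ₛ (translate p) t i) (cong (_+ at t i) (eval-translate p i))

  _⊞_ : Seq → Seq → Seq
  poly p  ⊞ t       = p ⊞ₛ t
  (c ▹ s) ⊞ poly q  = q ⊞ₛ (c ▹ s)
  (c ▹ s) ⊞ (d ▹ t) = c + d ▹ s ⊞ t

  at-⊞ : ∀ s t i → at (s ⊞ t) i ≡ at s i + at t i
  at-⊞ (poly p) t        i       = at-⊞ₛ p t i
  at-⊞ (c ▹ s)  (poly q) i       = trans (at-⊞ₛ q (c ▹ s) i) (+-comm (eval q i) _)
  at-⊞ (c ▹ s)  (d ▹ t)  zero    = refl
  at-⊞ (c ▹ s)  (d ▹ t)  (suc i) = at-⊞ s t i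

  infixr 6 _⊠_

  _⊠_ : ℕ → Seq → Seq
  k ⊠ poly p  = poly (List.map (k *_) p)
  k ⊠ (c ▹ s) = k * c ▹ k ⊠ s

  at-⊠ : ∀ k s i → at (k ⊠ s) i ≡ k * at s i
  at-⊠ k (poly []) i = sym (*-zeroʳ k)
  at-⊠ k (poly (c ∷ p)) i = trans (cong (λ x → k * c + i * x) (at-⊠ k (poly p) i)) (ring k c i (eval p i))
    where
    ring : ∀ k c i x → k * c + i * (k * x) ≡ k * (c + i * x)
    ring = solve-∀
  at-⊠ k (c ▹ s) zero    = refl
  at-⊠ k (c ▹ s) (suc i) = at-⊠ k s i

  unroll : ℕ → Seq → Seq
  unroll zero    s        = s
  unroll (suc n) (poly p) = eval p 0 ▹ unroll n (poly (translate p))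
  unroll (suc n) (c ▹ s)  = c ▹ unroll n s

  at-unroll : ∀ n s i → at (unroll n s) i ≡ at s i
  at-unroll zero    s        i       = refl
  at-unroll (suc n) (poly p) zero    = refl
  at-unroll (suc n) (poly p) (suc i) = trans (at-unroll n (poly (translate p)) i) (eval-translate p i)
  at-unroll (suc n) (c ▹ s)  zero    = refl
  at-unroll (suc n) (c ▹ s)  (suc i) = at-unroll n s i

  -- A normal form for prefixes of length at most 4 and polynomials of degree at most 4, through
  -- which linear relations between such sequences are verified by computation.
  normal : Seq → Seq
  normal s = unroll 4 (s ⊞ poly (0 ∷ 0 ∷ 0 ∷ 0 ∷ 0 ∷ []))

  at-normal : ∀ s i → at (normal s) i ≡ at s i
  at-normal s i = trans (at-unroll 4 (s ⊞ poly (0 ∷ 0 ∷ 0 ∷ 0 ∷ 0 ∷ [])) i)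
    (trans (at-⊞ s (poly (0 ∷ 0 ∷ 0 ∷ 0 ∷ 0 ∷ [])) i)
      (trans (cong (at s i +_) (zeros i)) (+-identityʳ _)))
    where
    zeros : ∀ i → 0 + i * (0 + i * (0 + i * (0 + i * (0 + i * 0)))) ≡ 0
    zeros = solve-∀

  normal-injective : ∀ {s t} → normal s ≡ normal t → ∀ i → at s i ≡ at t i
  normal-injective {s} {t} eq i = trans (sym (at-normal s i)) (trans (cong (λ n → at n i) eq) (at-normal t i))

  Code : Set
  Code = Bool → Seq

  ⟦_⟧ : Code → Series
  ⟦ C ⟧ p i = at (C p) i

  0ᶜ : Code
  0ᶜ _ = poly []

  _⊕_ : Code → Code → Code
  (C ⊕ D) p = C p ⊞ D p

  _⊛_ : ℕ → Code → Code
  (k ⊛ C) p = k ⊠ C p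

  infixr 5 _⊕_
  infixr 6 _⊛_

  shift : ℕ → Code → Code
  shift zero    C       = C
  shift (suc n) C false = 0 ▹ shift n C true
  shift (suc n) C true  = shift n C false

  ⟦shift⟧ : ∀ n C → ⟦ shift n C ⟧ ≗ˢ S^ n ⟦ C ⟧
  ⟦shift⟧ zero    C p i = refl
  ⟦shift⟧ (suc n) C false zero    = refl
  ⟦shift⟧ (suc n) C false (suc i) = ⟦shift⟧ n C true i
  ⟦shift⟧ (suc n) C true  i       = ⟦shift⟧ n C false i

  combine : List (ℕ × ℕ × Code) → Code
  combine []                p = poly []
  combine ((k , n , C) ∷ l) p = k ⊠ shift n C p ⊞ combine l p

  linear : List (ℕ × ℕ × Code) → Series
  linear []                p i = 0
  linear ((k , n , C) ∷ l) p i = k * S^ n ⟦ C ⟧ p i + linear l p i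

  ⟦combine⟧ : ∀ l → ⟦ combine l ⟧ ≗ˢ linear l
  ⟦combine⟧ []                p i = refl
  ⟦combine⟧ ((k , n , C) ∷ l) p i = trans (at-⊞ (k ⊠ shift n C p) (combine l p) i)
    (cong₂ _+_ (trans (at-⊠ k (shift n C p) i) (cong (k *_) (⟦shift⟧ n C p i))) (⟦combine⟧ l p i))

  -- Polynomials of degree at most 4 in the basis of falling factorials.
  newton : ℕ → (ℕ → ℕ) → ℕ
  newton n x = sum (applyUpTo (λ q → fall n q * x q) 5)

  module _ (n : ℕ) where

    newton-cong : ∀ {x y : ℕ → ℕ} → (∀ q → q < 5 → x q ≡ y q) → newton n x ≡ newton n y
    newton-cong eq = sum-applyUpTo-cong 5 λ q q<5 → cong (fall n q *_) (eq q q<5)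

    newton-+ : ∀ (x y : ℕ → ℕ) → newton n (λ q → x q + y q) ≡ newton n x + newton n y
    newton-+ x y = trans (sum-applyUpTo-cong 5 λ q _ → *-distribˡ-+ (fall n q) (x q) (y q))
      (sum-applyUpTo-+ 5 (λ q → fall n q * x q) (λ q → fall n q * y q))

    newton-* : ∀ k (x : ℕ → ℕ) → newton n (λ q → k * x q) ≡ k * newton n x
    newton-* k x = ring k (fall n 1) (fall n 2) (fall n 3) (fall n 4) (x 0) (x 1) (x 2) (x 3) (x 4)
      where
      ring : ∀ k f g h l x y z w v →
        1 * (k * x) + (f * (k * y) + (g * (k * z) + (h * (k * w) + (l * (k * v) + 0)))) ≡
        k * (1 * x + (f * y + (g * z + (h * w + (l * v + 0)))))
      ring = solve-∀

    newton-0 : newton n (λ _ → 0) ≡ 0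
    newton-0 = newton-* 0 (λ _ → 0)

    -- By Pascal's rule for falling factorials; `x 5 ≡ 0` ensures that the cut after five terms
    -- loses nothing.
    newton-suc : ∀ (x : ℕ → ℕ) → x 5 ≡ 0 → newton (suc n) x ≡ newton n (λ q → x q + suc q * x (suc q))
    newton-suc x x₅ = trans
      (cong₂ (λ (s , t) (u , v) → 1 * x 0 + (s * x 1 + (t * x 2 + (u * x 3 + (v * x 4 + 0)))))
        (cong₂ _,_ (fall-pascal n 0) (fall-pascal n 1)) (cong₂ _,_ (fall-pascal n 2) (fall-pascal n 3)))
      (trans (ring (fall n 1) (fall n 2) (fall n 3) (fall n 4) (x 0) (x 1) (x 2) (x 3) (x 4))
        (cong (λ x₅ → 1 * (x 0 + 1 * x 1) + (fall n 1 * (x 1 + 2 * x 2) + (fall n 2 * (x 2 + 3 * x 3)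
                      + (fall n 3 * (x 3 + 4 * x 4) + (fall n 4 * (x 4 + 5 * x₅) + 0))))) (sym x₅)))
      where
      ring : ∀ f g h l x y z w v →
        1 * x + ((f + 1 * 1) * y + ((g + 2 * f) * z + ((h + 3 * g) * w + ((l + 4 * h) * v + 0)))) ≡
        1 * (x + 1 * y) + (f * (y + 2 * z) + (g * (z + 3 * w) + (h * (w + 4 * v) + (l * (v + 5 * 0) + 0))))
      ring = solve-∀

  n*fall : ∀ n q → n * fall n q ≡ fall n (suc q) + q * fall n q
  n*fall zero    zero    = refl
  n*fall zero    (suc q) = sym (*-zeroʳ q)
  n*fall (suc n) zero    = sym (+-identityʳ _)
  n*fall (suc n) (suc q) = begin
    suc n * (suc n * fall n q)                                     ≡⟨ ring n (fall n q) ⟩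
    suc n * (n * fall n q) + suc n * fall n q                      ≡⟨ cong (λ x → suc n * x + suc n * fall n q) (n*fall n q) ⟩
    suc n * (fall n (suc q) + q * fall n q) + suc n * fall n q     ≡⟨ ring′ n q (fall n (suc q)) (fall n q) ⟩
    suc n * fall n (suc q) + suc q * (suc n * fall n q)            ∎
    where
    open ≡-Reasoning
    ring : ∀ n x → suc n * (suc n * x) ≡ suc n * (n * x) + suc n * x
    ring = solve-∀
    ring′ : ∀ n q x y → suc n * (x + q * y) + suc n * y ≡ suc n * x + suc q * (suc n * y)
    ring′ = solve-∀

  -- Multiplication of a Newton polynomial by its variable, read off from `n*fall`.
  raiseTerms : (ℕ → Code) → ℕ → List (ℕ × ℕ × Code)
  raiseTerms C zero    = []
  raiseTerms C (suc q) = (1 , 0 , C q) ∷ (suc q , 0 , C (suc q)) ∷ []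

  raise : (ℕ → Code) → ℕ → Code
  raise C q = combine (raiseTerms C q)

  -- The product has to stay within degree 4, hence the hypothesis on `C 4`.
  newton-raise : ∀ n C p i → ⟦ C 4 ⟧ p i ≡ 0 →
    newton n (λ q → ⟦ raise C q ⟧ p i) ≡ n * newton n (λ q → ⟦ C q ⟧ p i)
  newton-raise n C p i C₄ = begin
    newton n (λ q → ⟦ raise C q ⟧ p i)
      ≡⟨ newton-cong n (λ q _ → ⟦combine⟧ (raiseTerms C q) p i) ⟩
    raised (x 4)
      ≡⟨ cong raised C₄ ⟩
    raised 0
      ≡⟨ ring (fall n 1) (fall n 2) (fall n 3) (fall n 4) (x 0) (x 1) (x 2) (x 3) ⟩
    scaled (fall n 1 + 0 * 1) (fall n 2 + 1 * fall n 1) (fall n 3 + 2 * fall n 2) (fall n 4 + 3 * fall n 3)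
      ≡⟨ cong₂ (λ (s , t) (u , v) → scaled s t u v)
           (cong₂ _,_ (n*fall n 0) (n*fall n 1)) (cong₂ _,_ (n*fall n 2) (n*fall n 3)) ⟨
    scaled (n * fall n 0) (n * fall n 1) (n * fall n 2) (n * fall n 3)
      ≡⟨ ring′ n (fall n 1) (fall n 2) (fall n 3) (fall n 4) (x 0) (x 1) (x 2) (x 3) ⟩
    n * (1 * x 0 + (fall n 1 * x 1 + (fall n 2 * x 2 + (fall n 3 * x 3 + (fall n 4 * 0 + 0)))))
      ≡⟨ cong (λ x₄ → n * (1 * x 0 + (fall n 1 * x 1 + (fall n 2 * x 2 + (fall n 3 * x 3 + (fall n 4 * x₄ + 0)))))) C₄ ⟨
    n * newton n x ∎
    where
    open ≡-Reasoning
    x : ℕ → ℕ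
    x q = ⟦ C q ⟧ p i
    raised : ℕ → ℕ
    raised x₄ = 1 * 0 + (fall n 1 * (1 * x 0 + (1 * x 1 + 0)) + (fall n 2 * (1 * x 1 + (2 * x 2 + 0))
      + (fall n 3 * (1 * x 2 + (3 * x 3 + 0)) + (fall n 4 * (1 * x 3 + (4 * x₄ + 0)) + 0))))
    scaled : ℕ → ℕ → ℕ → ℕ → ℕ
    scaled s t u v = s * x 0 + (t * x 1 + (u * x 2 + v * x 3))
    ring : ∀ f g h l x y z w →
      1 * 0 + (f * (1 * x + (1 * y + 0)) + (g * (1 * y + (2 * z + 0))
        + (h * (1 * z + (3 * w + 0)) + (l * (1 * w + (4 * 0 + 0)) + 0)))) ≡
      (f + 0 * 1) * x + ((g + 1 * f) * y + ((h + 2 * g) * z + (l + 3 * h) * w))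
    ring = solve-∀
    ring′ : ∀ n f g h l x y z w →
      (n * 1) * x + ((n * f) * y + ((n * g) * z + (n * h) * w)) ≡
      n * (1 * x + (f * y + (g * z + (h * w + (l * 0 + 0)))))
    ring′ = solve-∀

  -- k T^n C_{q+n} with k = (q+n choose n).
  momentTerms : (ℕ → Code) → ℕ → List (ℕ × ℕ × Code)
  momentTerms C 0 = (1 , 0 , C 0) ∷ (1 , 1 , C 1) ∷ (1 , 2 , C 2) ∷ (1 , 3 , C 3) ∷ (1 , 4 , C 4) ∷ []
  momentTerms C 1 = (1 , 0 , C 1) ∷ (2 , 1 , C 2) ∷ (3 , 2 , C 3) ∷ (4 , 3 , C 4) ∷ []
  momentTerms C 2 = (1 , 0 , C 2) ∷ (3 , 1 , C 3) ∷ (6 , 2 , C 4) ∷ []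
  momentTerms C 3 = (1 , 0 , C 3) ∷ (4 , 1 , C 4) ∷ []
  momentTerms C 4 = (1 , 0 , C 4) ∷ []
  momentTerms C _ = []

  moments : (ℕ → Code) → ℕ → Code
  moments C q = combine (momentTerms C q)

  ∑-shifted : ∀ b C p i →
    sum (applyUpTo (λ q → shifted b q ⟦ C q ⟧ p i) 5) ≡ newton b (λ q → ⟦ moments C q ⟧ p i)
  ∑-shifted b C p i = begin
    sum (applyUpTo (λ q → shifted b q ⟦ C q ⟧ p i) 5)
      ≡⟨ cong₂ _+_ (shifted-0 ⟦ C 0 ⟧ p i b) (cong₂ _+_ (shifted-1 ⟦ C 1 ⟧ p i b) (cong₂ _+_ (shifted-2 ⟦ C 2 ⟧ p i b)
           (cong₂ _+_ (shifted-3 ⟦ C 3 ⟧ p i b) (cong (_+ 0) (shifted-4 ⟦ C 4 ⟧ p i b))))) ⟩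
    _
      ≡⟨ ring (fall b 1) (fall b 2) (fall b 3) (fall b 4) (c 0 0) (c 0 1) (c 1 1) (c 0 2) (c 1 2) (c 2 2)
           (c 0 3) (c 1 3) (c 2 3) (c 3 3) (c 0 4) (c 1 4) (c 2 4) (c 3 4) (c 4 4) ⟩
    newton b (λ q → linear (momentTerms C q) p i)
      ≡⟨ newton-cong b (λ q _ → ⟦combine⟧ (momentTerms C q) p i) ⟨
    newton b (λ q → ⟦ moments C q ⟧ p i) ∎
    where
    open ≡-Reasoning
    c : ℕ → ℕ → ℕ
    c n q = S^ n ⟦ C q ⟧ p i
    ring : ∀ f g h l x₀ x₁ y₁ x₂ y₂ z₂ x₃ y₃ z₃ w₃ x₄ y₄ z₄ w₄ v₄ →
      x₀ + ((f * x₁ + y₁) + ((g * x₂ + 2 * f * y₂ + z₂) + ((h * x₃ + 3 * g * y₃ + 3 * f * z₃ + w₃)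
        + ((l * x₄ + 4 * h * y₄ + 6 * g * z₄ + 4 * f * w₄ + v₄) + 0)))) ≡
      1 * (1 * x₀ + (1 * y₁ + (1 * z₂ + (1 * w₃ + (1 * v₄ + 0)))))
        + (f * (1 * x₁ + (2 * y₂ + (3 * z₃ + (4 * w₄ + 0))))
        + (g * (1 * x₂ + (3 * y₃ + (6 * z₄ + 0)))
        + (h * (1 * x₃ + (4 * y₄ + 0))
        + (l * (1 * x₄ + 0) + 0))))
    ring = solve-∀

  ∑-Φ : ∀ m c N (k : ℕ → ℕ) (h : ℕ → Series) →
    Φ m c (λ p i → sum (applyUpTo (λ q → k q * h q p i) N)) ≡ sum (applyUpTo (λ q → k q * Φ m c (h q)) N)
  ∑-Φ m c zero    k h = Φ-* m c 0 (λ _ _ → 0)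
  ∑-Φ m c (suc N) k h = trans (Φ-+ m c (λ p i → k 0 * h 0 p i) (λ p i → sum (applyUpTo (λ q → k (suc q) * h (suc q) p i) N)))
    (cong₂ _+_ (Φ-* m c (k 0) (h 0)) (∑-Φ m c N (k ∘ suc) (h ∘ suc)))

  Φ-newton : ∀ m c a (h : ℕ → Series) → Φ m c (λ p i → newton a (λ q → h q p i)) ≡ newton a (λ q → Φ m c (h q))
  Φ-newton m c a h = ∑-Φ m c 5 (fall a) h

  split-∑ : ∀ m N (f : ℕ → ℕ → ℕ → ℕ) →
    split m (λ i j → sum (applyUpTo (λ q → f q i j) N)) ≡ sum (applyUpTo (λ q → split m (f q)) N)
  split-∑ m zero    f = split-0 m
  split-∑ m (suc N) f = trans (split-+ m (f 0) (λ i j → sum (applyUpTo (λ q → f (suc q) i j) N)))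
    (cong (split m (f 0) +_) (split-∑ m N (f ∘ suc)))

  split-newton : ∀ m a (f : ℕ → ℕ → ℕ → ℕ) →
    split m (λ i j → newton a (λ q → f q i j)) ≡ newton a (λ q → split m (f q))
  split-newton m a f = trans (split-∑ m 5 (λ q i j → fall a q * f q i j))
    (sum-applyUpTo-cong 5 λ q _ → split-* m (fall a q) (f q))

  split-moments : ∀ m c b (C : ℕ → Code) →
    split m (λ j m′ → Φ m′ (c + j) (λ p i → newton (b + j) (λ q → ⟦ C q ⟧ p i))) ≡
    Φ m (suc c) (λ p i → newton b (λ q → ⟦ moments C q ⟧ p i))
  split-moments m c b C = begin
    split m (λ j m′ → Φ m′ (c + j) (λ p i → newton (b + j) (λ q → ⟦ C q ⟧ p i)))
      ≡⟨ split-cong m (λ j m′ _ → Φ-newton m′ (c + j) (b + j) (λ q → ⟦ C q ⟧)) ⟩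
    split m (λ j m′ → newton (b + j) (λ q → Φ m′ (c + j) ⟦ C q ⟧))
      ≡⟨ split-∑ m 5 (λ q j m′ → fall (b + j) q * Φ m′ (c + j) ⟦ C q ⟧) ⟩
    sum (applyUpTo (λ q → split m (λ j m′ → fall (b + j) q * Φ m′ (c + j) ⟦ C q ⟧)) 5)
      ≡⟨ sum-applyUpTo-cong 5 (λ q _ → trans (split-shifted b q m c ⟦ C q ⟧) (sym (*-identityˡ (Φ m (suc c) (shifted b q ⟦ C q ⟧))))) ⟩
    sum (applyUpTo (λ q → 1 * Φ m (suc c) (shifted b q ⟦ C q ⟧)) 5)
      ≡⟨ ∑-Φ m (suc c) 5 (λ _ → 1) (λ q → shifted b q ⟦ C q ⟧) ⟨
    Φ m (suc c) (λ p i → sum (applyUpTo (λ q → 1 * shifted b q ⟦ C q ⟧ p i) 5))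
      ≡⟨ Φ-cong m (suc c) (λ p i → trans (sum-applyUpTo-cong 5 λ q _ → *-identityˡ (shifted b q ⟦ C q ⟧ p i)) (∑-shifted b C p i)) ⟩
    Φ m (suc c) (λ p i → newton b (λ q → ⟦ moments C q ⟧ p i)) ∎
    where open ≡-Reasoning

  -- Polynomials in two variables over power series

  Table : Set
  Table = ℕ → ℕ → Code

  bivariate : Table → ℕ → ℕ → Series
  bivariate D a b p i = newton a (λ u → newton b (λ v → ⟦ D u v ⟧ p i))

  -- Removing a row marks `j` further columns, so only the second variable is averaged.
  split-bivariate : ∀ m c a b D →
    split m (λ j m′ → Φ m′ (c + j) (bivariate D a (b + j))) ≡ Φ m (suc c) (bivariate (moments ∘ D) a b)
  split-bivariate m c a b D = begin
    split m (λ j m′ → Φ m′ (c + j) (bivariate D a (b + j)))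
      ≡⟨ split-cong m (λ j m′ _ → Φ-newton m′ (c + j) a (λ u p i → newton (b + j) (λ v → ⟦ D u v ⟧ p i))) ⟩
    split m (λ j m′ → newton a (λ u → Φ m′ (c + j) (λ p i → newton (b + j) (λ v → ⟦ D u v ⟧ p i))))
      ≡⟨ split-newton m a (λ u j m′ → Φ m′ (c + j) (λ p i → newton (b + j) (λ v → ⟦ D u v ⟧ p i))) ⟩
    newton a (λ u → split m (λ j m′ → Φ m′ (c + j) (λ p i → newton (b + j) (λ v → ⟦ D u v ⟧ p i))))
      ≡⟨ newton-cong a (λ u _ → split-moments m c b (D u)) ⟩
    newton a (λ u → Φ m (suc c) (λ p i → newton b (λ v → ⟦ moments (D u) v ⟧ p i)))
      ≡⟨ Φ-newton m (suc c) a (λ u p i → newton b (λ v → ⟦ moments (D u) v ⟧ p i)) ⟨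
    Φ m (suc c) (bivariate (moments ∘ D) a b) ∎
    where open ≡-Reasoning

  sum-applyUpTo-swap : ∀ M N (f : ℕ → ℕ → ℕ) →
    sum (applyUpTo (λ u → sum (applyUpTo (f u) N)) M) ≡ sum (applyUpTo (λ v → sum (applyUpTo (λ u → f u v) M)) N)
  sum-applyUpTo-swap zero    N f = sym (zeros N)
    where
    zeros : ∀ N → sum (applyUpTo (λ _ → 0) N) ≡ 0
    zeros zero    = refl
    zeros (suc N) = zeros N
  sum-applyUpTo-swap (suc M) N f = trans (cong (sum (applyUpTo (f 0) N) +_) (sum-applyUpTo-swap M N (f ∘ suc)))
    (sym (sum-applyUpTo-+ N (f 0) (λ v → sum (applyUpTo (λ u → f (suc u) v) M))))

  normalRow : (ℕ → Code) → List (Seq × Seq)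
  normalRow C = applyUpTo (λ v → normal (C v false) , normal (C v true)) 5

  infix 4 _≋_
  -- A single closed equation between 5 by 5 arrays of normal forms: for concrete tables it holds by
  -- `refl`, and `≋⇒≗` recovers the equality of all coefficients.
  _≋_ : Table → Table → Set
  D ≋ D′ = applyUpTo (normalRow ∘ D) 5 ≡ applyUpTo (normalRow ∘ D′) 5

  applyUpTo-injective : ∀ {A : Set} n {f g : ℕ → A} → applyUpTo f n ≡ applyUpTo g n → ∀ i → i < n → f i ≡ g i
  applyUpTo-injective (suc n) eq zero    _         = List.∷-injectiveˡ eq
  applyUpTo-injective (suc n) eq (suc i) (s≤s i<n) = applyUpTo-injective n (List.∷-injectiveʳ eq) i i<n

  ≋⇒≗ : ∀ {D D′} → D ≋ D′ → ∀ u → u < 5 → ∀ v → v < 5 → ⟦ D u v ⟧ ≗ˢ ⟦ D′ u v ⟧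
  ≋⇒≗ {D} {D′} eq u u<5 v v<5 p = normal-injective {D u v p} {D′ u v p} (at-parity p)
    where
    entries : (normal (D u v false) , normal (D u v true)) ≡ (normal (D′ u v false) , normal (D′ u v true))
    entries = applyUpTo-injective 5 {λ v → normal (D u v false) , normal (D u v true)}
      {λ v → normal (D′ u v false) , normal (D′ u v true)}
      (applyUpTo-injective 5 {normalRow ∘ D} {normalRow ∘ D′} eq u u<5) v v<5
    at-parity : ∀ p → normal (D u v p) ≡ normal (D′ u v p)
    at-parity false = Product.,-injectiveˡ entries
    at-parity true  = Product.,-injectiveʳ entries

  bivariate-flip : ∀ {D : Table} → D ≋ flip D → ∀ a b → bivariate D a b ≗ˢ bivariate D b a
  bivariate-flip {D} sym-D a b p i = begin
    newton a (λ u → newton b (λ v → ⟦ D u v ⟧ p i))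
      ≡⟨ newton-cong a (λ u u<5 → newton-cong b λ v v<5 → ≋⇒≗ {D} {flip D} sym-D u u<5 v v<5 p i) ⟩
    newton a (λ u → newton b (λ v → ⟦ D v u ⟧ p i))
      ≡⟨ sum-applyUpTo-cong 5 (λ u _ → newton-* b (fall a u) (λ v → ⟦ D v u ⟧ p i)) ⟨
    sum (applyUpTo (λ u → sum (applyUpTo (λ v → fall b v * (fall a u * ⟦ D v u ⟧ p i)) 5)) 5)
      ≡⟨ sum-applyUpTo-swap 5 5 (λ u v → fall b v * (fall a u * ⟦ D v u ⟧ p i)) ⟩
    sum (applyUpTo (λ v → sum (applyUpTo (λ u → fall b v * (fall a u * ⟦ D v u ⟧ p i)) 5)) 5)
      ≡⟨ sum-applyUpTo-cong 5 (λ v _ → ∑-* 5 (fall b v) (λ u → fall a u * ⟦ D v u ⟧ p i)) ⟩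
    newton b (λ v → newton a (λ u → ⟦ D v u ⟧ p i)) ∎
    where
    open ≡-Reasoning
    ∑-* : ∀ N k (x : ℕ → ℕ) → sum (applyUpTo (λ u → k * x u) N) ≡ k * sum (applyUpTo x N)
    ∑-* zero    k x = sym (*-zeroʳ k)
    ∑-* (suc N) k x = trans (cong (k * x 0 +_) (∑-* N k (x ∘ suc))) (sym (*-distribˡ-+ k (x 0) _))

  bivariate-cong : ∀ {D D′ : Table} → D ≋ D′ → ∀ a b → bivariate D a b ≗ˢ bivariate D′ a b
  bivariate-cong {D} {D′} eq a b p i = newton-cong a λ u u<5 → newton-cong b λ v v<5 → ≋⇒≗ {D} {D′} eq u u<5 v v<5 p i

  bivariate-⊕ : ∀ (D D′ : Table) a b p i →
    bivariate (λ u v → D u v ⊕ D′ u v) a b p i ≡ bivariate D a b p i + bivariate D′ a b p i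
  bivariate-⊕ D D′ a b p i = begin
    newton a (λ u → newton b (λ v → at (D u v p ⊞ D′ u v p) i))
      ≡⟨ newton-cong a (λ u _ → trans (newton-cong b λ v _ → at-⊞ (D u v p) (D′ u v p) i)
           (newton-+ b (λ v → ⟦ D u v ⟧ p i) (λ v → ⟦ D′ u v ⟧ p i))) ⟩
    newton a (λ u → newton b (λ v → ⟦ D u v ⟧ p i) + newton b (λ v → ⟦ D′ u v ⟧ p i))
      ≡⟨ newton-+ a (λ u → newton b (λ v → ⟦ D u v ⟧ p i)) (λ u → newton b (λ v → ⟦ D′ u v ⟧ p i)) ⟩
    bivariate D a b p i + bivariate D′ a b p i ∎
    where open ≡-Reasoning

  bivariate-suc : ∀ (D : Table) → (∀ v → D 5 v ≡ 0ᶜ) → ∀ a b p i →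
    bivariate D (suc a) b p i ≡ bivariate (λ u v → D u v ⊕ suc u ⊛ D (suc u) v) a b p i
  bivariate-suc D D₅ a b p i = begin
    newton (suc a) row
      ≡⟨ newton-suc a row (trans (newton-cong b λ v _ → cong (λ C → ⟦ C ⟧ p i) (D₅ v)) (newton-0 b)) ⟩
    newton a (λ u → row u + suc u * row (suc u))
      ≡⟨ newton-cong a (λ u _ → trans (cong (row u +_) (sym (newton-* b (suc u) (λ v → ⟦ D (suc u) v ⟧ p i))))
           (trans (sym (newton-+ b (λ v → ⟦ D u v ⟧ p i) (λ v → suc u * ⟦ D (suc u) v ⟧ p i)))
             (newton-cong b λ v _ → sym (trans (at-⊞ (D u v p) (suc u ⊠ D (suc u) v p) i)
               (cong (⟦ D u v ⟧ p i +_) (at-⊠ (suc u) (D (suc u) v p) i)))))) ⟩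
    bivariate (λ u v → D u v ⊕ suc u ⊛ D (suc u) v) a b p i ∎
    where
    open ≡-Reasoning
    row : ℕ → ℕ
    row u = newton b (λ v → ⟦ D u v ⟧ p i)

  bivariate-raise : ∀ (D : Table) → (∀ u → u < 5 → ∀ p i → ⟦ D u 4 ⟧ p i ≡ 0) → ∀ a b p i →
    bivariate (raise ∘ D) a b p i ≡ b * bivariate D a b p i
  bivariate-raise D D₄ a b p i = trans
    (newton-cong a λ u u<5 → newton-raise b (D u) p i (D₄ u u<5 p i))
    (newton-* a b (λ u → newton b (λ v → ⟦ D u v ⟧ p i)))

  -- Forests with at most two extra edges

  eachParity : Seq → Seq → Code
  eachParity s t false = s
  eachParity s t true  = t

  -- 144 times the generating functions of rooted forests with 0, 1 and 2 extra edges, divided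
  -- by exp((a+b)T): the last two are polynomials in a and b, given by their coefficients with
  -- respect to the falling factorials of a and b. The sequences list the coefficients of T^(2i) and
  -- of T^(2i+1); they were found by solving the recurrences g₁-next and g₂-next.
  g₀ : Code
  g₀ = eachParity (144 ▹ poly []) (poly [])

  g₁ : Table
  g₁ 0 1 = eachParity (0 ▹ poly (0 ∷ 72 ∷ [])) (poly (0 ∷ 72 ∷ []))
  g₁ 1 0 = g₁ 0 1
  g₁ 0 2 = eachParity (poly []) (poly (72 ∷ []))
  g₁ 1 1 = eachParity (poly (144 ∷ [])) (poly [])
  g₁ 2 0 = g₁ 0 2
  g₁ _ _ = 0ᶜ

  g₂ : Table
  g₂ 0 1 = eachParity (0 ▹ 0 ▹ poly (60 ∷ 220 ∷ 252 ∷ 107 ∷ 15 ∷ [])) (0 ▹ poly (0 ∷ 61 ∷ 123 ∷ 77 ∷ 15 ∷ []))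
  g₂ 1 0 = g₂ 0 1
  g₂ 0 2 = eachParity (0 ▹ poly (36 ∷ 123 ∷ 99 ∷ 30 ∷ [])) (poly (0 ∷ 42 ∷ 72 ∷ 30 ∷ []))
  g₂ 1 1 = eachParity (0 ▹ poly (144 ∷ 354 ∷ 234 ∷ 60 ∷ [])) (poly (0 ∷ 120 ∷ 108 ∷ 60 ∷ []))
  g₂ 2 0 = g₂ 0 2
  g₂ 0 3 = eachParity (poly (0 ∷ 42 ∷ 30 ∷ [])) (poly (24 ∷ 18 ∷ 30 ∷ []))
  g₂ 1 2 = eachParity (poly (72 ∷ 54 ∷ 90 ∷ [])) (poly (144 ∷ 198 ∷ 90 ∷ []))
  g₂ 2 1 = g₂ 1 2
  g₂ 3 0 = g₂ 0 3
  g₂ 0 4 = eachParity (poly (0 ∷ 18 ∷ [])) (poly [])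
  g₂ 1 3 = eachParity (poly []) (poly (72 ∷ 72 ∷ []))
  g₂ 2 2 = eachParity (poly (72 ∷ 108 ∷ [])) (poly [])
  g₂ 3 1 = g₂ 1 3
  g₂ 4 0 = g₂ 0 4
  g₂ _ _ = 0ᶜ

  g₁-sym : g₁ ≋ flip g₁
  g₁-sym = refl

  g₂-sym : g₂ ≋ flip g₂
  g₂-sym = refl

  -- The vertex being removed has b marked neighbours to choose from: joining it to one or two of
  -- these adds as many extra edges.
  oneEdge twoEdges : Table
  oneEdge 0 1 = g₀
  oneEdge _ _ = 0ᶜ
  twoEdges 0 2 = eachParity (72 ▹ poly []) (poly [])
  twoEdges _ _ = 0ᶜ

  -- The Newton coefficients after replacing a by a + 1.
  next : Table → Table
  next D u v = D u v ⊕ suc u ⊛ D (suc u) v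

  g₁-next : next g₁ ≋ λ u v → moments (g₁ u) v ⊕ oneEdge u v
  g₁-next = refl

  -- The terms stand for 0, 1 and 2 extra edges at the removed row; `raise` is the factor b for the
  -- choice of a single one.
  g₂-next : next g₂ ≋ λ u v → moments (g₂ u) v ⊕ raise (moments (g₁ u)) v ⊕ twoEdges u v
  g₂-next = refl

  newton-constant : ∀ n (x : ℕ → ℕ) c → x 0 ≡ c → (∀ q → x (suc q) ≡ 0) → newton n x ≡ c
  newton-constant n x c x₀ x₁₊ = trans
    (newton-cong n {x} {λ { zero → c ; (suc _) → 0 }} λ { zero _ → x₀ ; (suc q) _ → x₁₊ q })
    (ring (fall n 1) (fall n 2) (fall n 3) (fall n 4) c)
    where
    ring : ∀ f g h l c → 1 * c + (f * 0 + (g * 0 + (h * 0 + (l * 0 + 0)))) ≡ c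
    ring = solve-∀

  fall-1 : ∀ n → fall n 1 ≡ n
  fall-1 zero    = refl
  fall-1 (suc n) = *-identityʳ (suc n)

  bivariate-oneEdge : ∀ a b p i → bivariate oneEdge a b p i ≡ b * ⟦ g₀ ⟧ p i
  bivariate-oneEdge a b p i = newton-constant a (λ u → newton b (λ v → ⟦ oneEdge u v ⟧ p i)) (b * ⟦ g₀ ⟧ p i)
    (trans (ring (fall b 1) (fall b 2) (fall b 3) (fall b 4) (⟦ g₀ ⟧ p i)) (cong (_* ⟦ g₀ ⟧ p i) (fall-1 b)))
    (λ _ → newton-0 b)
    where
    ring : ∀ f g h l c → 1 * 0 + (f * c + (g * 0 + (h * 0 + (l * 0 + 0)))) ≡ f * c
    ring = solve-∀

  -- The binomial coefficient (b choose 2), by recursion to avoid halving.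
  triangle : ℕ → ℕ
  triangle zero    = 0
  triangle (suc b) = b + triangle b

  fall-2 : ∀ n → fall n 2 ≡ triangle n * 2
  fall-2 zero    = refl
  fall-2 (suc n) = trans (fall-pascal n 1) (trans (cong₂ (λ x y → x + 2 * y) (fall-2 n) (fall-1 n)) (ring n (triangle n)))
    where
    ring : ∀ n t → t * 2 + 2 * n ≡ (n + t) * 2
    ring = solve-∀

  -- The table has 72, half of 144, because (b choose 2) is half the second falling factorial.
  bivariate-twoEdges : ∀ a b p i → bivariate twoEdges a b p i ≡ triangle b * ⟦ g₀ ⟧ p i
  bivariate-twoEdges a b p i = newton-constant a (λ u → newton b (λ v → ⟦ twoEdges u v ⟧ p i)) (triangle b * ⟦ g₀ ⟧ p i)
    (begin
      newton b (λ v → ⟦ twoEdges 0 v ⟧ p i)   ≡⟨ ring (fall b 1) (fall b 2) (fall b 3) (fall b 4) (⟦ twoEdges 0 2 ⟧ p i) ⟩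
      fall b 2 * ⟦ twoEdges 0 2 ⟧ p i         ≡⟨ cong (_* ⟦ twoEdges 0 2 ⟧ p i) (fall-2 b) ⟩
      triangle b * 2 * ⟦ twoEdges 0 2 ⟧ p i   ≡⟨ *-assoc (triangle b) 2 _ ⟩
      triangle b * (2 * ⟦ twoEdges 0 2 ⟧ p i) ≡⟨ cong (triangle b *_) (double p i) ⟩
      triangle b * ⟦ g₀ ⟧ p i            ∎)
    (λ _ → newton-0 b)
    where
    open ≡-Reasoning
    ring : ∀ f g h l c → 1 * 0 + (f * 0 + (g * c + (h * 0 + (l * 0 + 0)))) ≡ g * c
    ring = solve-∀
    double : ∀ p i → 2 * ⟦ twoEdges 0 2 ⟧ p i ≡ ⟦ g₀ ⟧ p i
    double false zero    = refl
    double false (suc i) = refl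
    double true  i       = refl

  -- MG₁ a b and MG₂ a b average G₁ a (b + J) and G₂ a (b + J) over J Poisson of mean T.
  G₁ G₂ MG₁ MG₂ : ℕ → ℕ → Series
  G₁  = bivariate g₁
  G₂  = bivariate g₂
  MG₁ = bivariate (moments ∘ g₁)
  MG₂ = bivariate (moments ∘ g₂)

  G₁-suc : ∀ a b p i → G₁ (suc a) b p i ≡ MG₁ a b p i + b * ⟦ g₀ ⟧ p i
  G₁-suc a b p i = begin
    G₁ (suc a) b p i                       ≡⟨ bivariate-suc g₁ (λ _ → refl) a b p i ⟩
    bivariate (next g₁) a b p i            ≡⟨ bivariate-cong {next g₁} {λ u v → moments (g₁ u) v ⊕ oneEdge u v} g₁-next a b p i ⟩
    bivariate (λ u v → moments (g₁ u) v ⊕ oneEdge u v) a b p i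
                                           ≡⟨ bivariate-⊕ (moments ∘ g₁) oneEdge a b p i ⟩
    MG₁ a b p i + bivariate oneEdge a b p i    ≡⟨ cong (MG₁ a b p i +_) (bivariate-oneEdge a b p i) ⟩
    MG₁ a b p i + b * ⟦ g₀ ⟧ p i           ∎
    where open ≡-Reasoning

  G₂-suc : ∀ a b p i → G₂ (suc a) b p i ≡ MG₂ a b p i + (b * MG₁ a b p i + triangle b * ⟦ g₀ ⟧ p i)
  G₂-suc a b p i = begin
    G₂ (suc a) b p i
      ≡⟨ bivariate-suc g₂ (λ _ → refl) a b p i ⟩
    bivariate (next g₂) a b p i
      ≡⟨ bivariate-cong {next g₂} {λ u v → moments (g₂ u) v ⊕ raise (moments (g₁ u)) v ⊕ twoEdges u v} g₂-next a b p i ⟩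
    bivariate (λ u v → moments (g₂ u) v ⊕ raise (moments (g₁ u)) v ⊕ twoEdges u v) a b p i
      ≡⟨ trans (bivariate-⊕ (moments ∘ g₂) (λ u v → raise (moments (g₁ u)) v ⊕ twoEdges u v) a b p i)
           (cong (MG₂ a b p i +_) (bivariate-⊕ (raise ∘ moments ∘ g₁) twoEdges a b p i)) ⟩
    MG₂ a b p i + (bivariate (raise ∘ moments ∘ g₁) a b p i + bivariate twoEdges a b p i)
      ≡⟨ cong (MG₂ a b p i +_) (cong₂ _+_ (bivariate-raise (moments ∘ g₁) degree a b p i) (bivariate-twoEdges a b p i)) ⟩
    MG₂ a b p i + (b * MG₁ a b p i + triangle b * ⟦ g₀ ⟧ p i) ∎
    where
    open ≡-Reasoning
    degree : ∀ u → u < 5 → ∀ p i → ⟦ moments (g₁ u) 4 ⟧ p i ≡ 0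
    degree 0 _ p i = refl
    degree 1 _ p i = refl
    degree 2 _ p i = refl
    degree (suc (suc (suc u))) _ p i = refl

  -- The arguments x, y and z are the weights of 0, 1 and 2 extra edges.
  weighted : (m a b x y z : ℕ) → ℕ
  weighted m a b x y z = x * Φ m (a + b) ⟦ g₀ ⟧ + (y * Φ m (a + b) (G₁ a b) + z * Φ m (a + b) (G₂ a b))

  -- By the symmetry of the tables. This reduces the removal of a column to that of a row, for which
  -- the recurrences were verified.
  weighted-flip : ∀ m a b x y z → weighted m a b x y z ≡ weighted m b a x y z
  weighted-flip m a b x y z = begin
    weighted m a b x y z
      ≡⟨ cong₂ (λ s t → x * Φ m (a + b) ⟦ g₀ ⟧ + (y * s + z * t))
           (Φ-cong m (a + b) (bivariate-flip {g₁} g₁-sym a b)) (Φ-cong m (a + b) (bivariate-flip {g₂} g₂-sym a b)) ⟩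
    x * Φ m (a + b) ⟦ g₀ ⟧ + (y * Φ m (a + b) (G₁ b a) + z * Φ m (a + b) (G₂ b a))
      ≡⟨ cong (λ c → x * Φ m c ⟦ g₀ ⟧ + (y * Φ m c (G₁ b a) + z * Φ m c (G₂ b a))) (+-comm a b) ⟩
    weighted m b a x y z ∎
    where open ≡-Reasoning

  module _ (m a b : ℕ) where

    private
      c = a + b
      K  = Φ m (suc c) ⟦ g₀ ⟧
      M₁ = Φ m (suc c) (MG₁ a b)
      M₂ = Φ m (suc c) (MG₂ a b)

    split-weighted : ∀ x y z →
      split m (λ j m′ → weighted m′ a (b + j) x y z) ≡ x * K + (y * M₁ + z * M₂)
    split-weighted x y z = begin
      split m (λ j m′ → weighted m′ a (b + j) x y z)
        ≡⟨ split-cong m (λ j m′ _ → cong (λ c → x * Φ m′ c ⟦ g₀ ⟧ + (y * Φ m′ c (G₁ a (b + j)) + z * Φ m′ c (G₂ a (b + j)))) (sym (+-assoc a b j))) ⟩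
      split m (λ j m′ → x * Φ m′ (c + j) ⟦ g₀ ⟧ + (y * Φ m′ (c + j) (G₁ a (b + j)) + z * Φ m′ (c + j) (G₂ a (b + j))))
        ≡⟨ trans (split-+ m (λ j m′ → x * Φ m′ (c + j) ⟦ g₀ ⟧) (λ j m′ → y * Φ m′ (c + j) (G₁ a (b + j)) + z * Φ m′ (c + j) (G₂ a (b + j))))
             (cong (split m (λ j m′ → x * Φ m′ (c + j) ⟦ g₀ ⟧) +_)
               (split-+ m (λ j m′ → y * Φ m′ (c + j) (G₁ a (b + j))) (λ j m′ → z * Φ m′ (c + j) (G₂ a (b + j))))) ⟩
      split m (λ j m′ → x * Φ m′ (c + j) ⟦ g₀ ⟧) + (split m (λ j m′ → y * Φ m′ (c + j) (G₁ a (b + j)))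
        + split m (λ j m′ → z * Φ m′ (c + j) (G₂ a (b + j))))
        ≡⟨ cong₂ _+_ (trans (split-* m x (λ j m′ → Φ m′ (c + j) ⟦ g₀ ⟧)) (cong (x *_) (split-Φ m c ⟦ g₀ ⟧)))
             (cong₂ _+_ (trans (split-* m y (λ j m′ → Φ m′ (c + j) (G₁ a (b + j)))) (cong (y *_) (split-bivariate m c a b g₁)))
                        (trans (split-* m z (λ j m′ → Φ m′ (c + j) (G₂ a (b + j)))) (cong (z *_) (split-bivariate m c a b g₂)))) ⟩
      x * K + (y * M₁ + z * M₂) ∎
      where open ≡-Reasoning

    weighted-suc : ∀ x y z → weighted m (suc a) b x y z ≡
      x * K + (y * (M₁ + b * K) + z * (M₂ + (b * M₁ + triangle b * K)))
    weighted-suc x y z = cong₂ (λ s t → x * K + (y * s + z * t))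
      (trans (Φ-cong m (suc c) (G₁-suc a b)) (trans (Φ-+ m (suc c) (MG₁ a b) (λ p i → b * ⟦ g₀ ⟧ p i))
        (cong (M₁ +_) (Φ-* m (suc c) b ⟦ g₀ ⟧))))
      (trans (Φ-cong m (suc c) (G₂-suc a b))
        (trans (Φ-+ m (suc c) (MG₂ a b) (λ p i → b * MG₁ a b p i + triangle b * ⟦ g₀ ⟧ p i))
          (cong (M₂ +_) (trans (Φ-+ m (suc c) (λ p i → b * MG₁ a b p i) (λ p i → triangle b * ⟦ g₀ ⟧ p i))
            (cong₂ _+_ (Φ-* m (suc c) b (MG₁ a b)) (Φ-* m (suc c) (triangle b) ⟦ g₀ ⟧))))))

  -- Solution of the exploration recurrence

  split-truncate₁ : ∀ b (ψ : ℕ → ℕ) → (∀ t → ψ (1 + t) ≡ 0) → split b (λ i _ → ψ i) ≡ ψ 0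
  split-truncate₁ zero    ψ v = refl
  split-truncate₁ (suc b) ψ v = cong₂ _+_ (trans (split-cong b λ i _ _ → v i) (split-0 b)) (split-truncate₁ b ψ v)

  split-truncate₂ : ∀ b (ψ : ℕ → ℕ) → (∀ t → ψ (2 + t) ≡ 0) → split b (λ i _ → ψ i) ≡ ψ 0 + b * ψ 1
  split-truncate₂ zero    ψ v = sym (+-identityʳ _)
  split-truncate₂ (suc b) ψ v = trans (cong₂ _+_ (split-truncate₁ b (ψ ∘ suc) v) (split-truncate₂ b ψ v))
    (ring b (ψ 0) (ψ 1))
    where
    ring : ∀ b x y → y + (x + b * y) ≡ x + suc b * y
    ring = solve-∀

  -- Each join of the removed row to an already marked column is an extra edge, so a weight that
  -- forbids three extra edges cuts the sum off after `i = 2`.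
  split-truncate₃ : ∀ b (ψ : ℕ → ℕ) → (∀ t → ψ (3 + t) ≡ 0) →
    split b (λ i _ → ψ i) ≡ ψ 0 + b * ψ 1 + triangle b * ψ 2
  split-truncate₃ zero    ψ v = sym (trans (+-identityʳ _) (+-identityʳ _))
  split-truncate₃ (suc b) ψ v = trans (cong₂ _+_ (split-truncate₂ b (ψ ∘ suc) v) (split-truncate₃ b ψ v))
    (ring b (triangle b) (ψ 0) (ψ 1) (ψ 2))
    where
    ring : ∀ b t x y z → y + b * z + (x + b * y + t * z) ≡ x + suc b * y + (b + t) * z
    ring = solve-∀

  module _ (n : ℕ) (IH : ∀ m a b φ → m + a + b ≡ n → (∀ t → φ (3 + m + t) ≡ 0) →
    144 * split m (λ r s → spannedCount n r s a b φ) ≡ weighted m a b (φ m) (φ (1 + m)) (φ (2 + m))) where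

    -- With `i` joins to marked and `j` to unmarked columns, m′ = m - j unmarked vertices remain. A
    -- forest on these has m′ edges, so `φ` is taken at i + m plus the number of extra edges that
    -- remain.
    removed-row : ∀ m a b φ → m + a + b ≡ n → (∀ t → φ (3 + m + t) ≡ 0) →
      144 * split m (λ r s → spannedCount (suc n) r s (suc a) b φ) ≡ weighted m (suc a) b (φ m) (φ (1 + m)) (φ (2 + m))
    removed-row m a b φ eq v = begin
      144 * split m (λ r s → split b λ i _ → split s λ j s′ → f i r j s′)
        -- The sum over `i` moves outside, and the `j` new marks are drawn from all `m` unmarked
        -- vertices before the rest is divided into rows and columns.
        ≡⟨ cong (144 *_) (trans (split-swap m b (λ r s i _ → split s λ j s′ → f i r j s′))
             (split-cong b λ i _ _ → split-assoc m (f i))) ⟩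
      144 * split b (λ i _ → split m λ j m′ → split m′ λ r s′ → f i r j s′)
        ≡⟨ trans (sym (split-* b 144 (λ i _ → split m λ j m′ → split m′ λ r s′ → f i r j s′)))
             (split-cong b λ i _ _ → sym (split-* m 144 (λ j m′ → split m′ λ r s′ → f i r j s′))) ⟩
      split b (λ i _ → split m λ j m′ → 144 * split m′ λ r s′ → f i r j s′)
        ≡⟨ split-cong b (λ i _ _ → trans (split-cong m (by-induction i)) (split-weighted m a b (φ (i + m)) (φ (1 + i + m)) (φ (2 + i + m)))) ⟩
      split b (λ i _ → φ (i + m) * K + (φ (1 + i + m) * M₁ + φ (2 + i + m) * M₂))
        ≡⟨ split-truncate₃ b ψ (λ t → cong₂ (λ x (y , z) → x * K + (y * M₁ + z * M₂)) (v′ t) (cong₂ _,_ (v′ (1 + t)) (v′ (2 + t)))) ⟩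
      ψ 0 + b * ψ 1 + triangle b * ψ 2
        ≡⟨ cong (λ (w , u) → ψ 0 + b * (φ (1 + m) * K + (φ (2 + m) * M₁ + w * M₂)) + triangle b * (φ (2 + m) * K + (w * M₁ + u * M₂))) (cong₂ _,_ (v′ 0) (v′ 1)) ⟩
      (φ m * K + (φ (1 + m) * M₁ + φ (2 + m) * M₂)) + b * (φ (1 + m) * K + (φ (2 + m) * M₁ + 0 * M₂))
        + triangle b * (φ (2 + m) * K + (0 * M₁ + 0 * M₂))
        ≡⟨ ring (φ m) (φ (1 + m)) (φ (2 + m)) b (triangle b) K M₁ M₂ ⟩
      φ m * K + (φ (1 + m) * (M₁ + b * K) + φ (2 + m) * (M₂ + (b * M₁ + triangle b * K)))
        ≡⟨ weighted-suc m a b (φ m) (φ (1 + m)) (φ (2 + m)) ⟨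
      weighted m (suc a) b (φ m) (φ (1 + m)) (φ (2 + m)) ∎
      where
      open ≡-Reasoning
      K  = Φ m (suc (a + b)) ⟦ g₀ ⟧
      M₁ = Φ m (suc (a + b)) (MG₁ a b)
      M₂ = Φ m (suc (a + b)) (MG₂ a b)
      ψ : ℕ → ℕ
      ψ i = φ (i + m) * K + (φ (1 + i + m) * M₁ + φ (2 + i + m) * M₂)
      f : ℕ → ℕ → ℕ → ℕ → ℕ
      f i r j s′ = spannedCount n r s′ a (b + j) (λ e → φ (i + j + e))
      v′ : ∀ t → φ (3 + t + m) ≡ 0
      v′ t = trans (cong (λ k → φ (3 + k)) (+-comm t m)) (v t)
      ring : ∀ x y z b t k p q → (x * k + (y * p + z * q)) + b * (y * k + (z * p + 0 * q)) + t * (z * k + (0 * p + 0 * q)) ≡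
        x * k + (y * (p + b * k) + z * (q + (b * p + t * k)))
      ring = solve-∀
      by-induction : ∀ i j m′ → j + m′ ≡ m →
        144 * split m′ (λ r s′ → f i r j s′) ≡ weighted m′ a (b + j) (φ (i + m)) (φ (1 + i + m)) (φ (2 + i + m))
      by-induction i j m′ refl = trans
        (IH m′ a (b + j) (λ e → φ (i + j + e)) (trans (ring₁ m′ a b j) eq)
          λ t → trans (cong φ (ring₂ i j m′ t)) (v′ (i + t)))
        (cong₂ (λ x (y , z) → weighted m′ a (b + j) (φ x) (φ y) (φ z))
          (+-assoc i j m′) (cong₂ _,_ (ring₃ i j m′) (ring₄ i j m′)))
        where
        ring₁ : ∀ m a b j → m + a + (b + j) ≡ j + m + a + b
        ring₁ = solve-∀
        ring₂ : ∀ i j m t → i + j + (3 + m + t) ≡ 3 + (i + t) + (j + m)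
        ring₂ = solve-∀
        ring₃ : ∀ i j m → i + j + (1 + m) ≡ 1 + i + (j + m)
        ring₃ = solve-∀
        ring₄ : ∀ i j m → i + j + (2 + m) ≡ 2 + i + (j + m)
        ring₄ = solve-∀

    -- With no marked row, the removed column has no extra edge; up to exchanging sides this is the
    -- removal of a row with `b` and 0 other marks.
    removed-column : ∀ m b φ → m + b ≡ n → (∀ t → φ (3 + m + t) ≡ 0) →
      144 * split m (λ r s → spannedCount (suc n) r s 0 (suc b) φ) ≡ weighted m 0 (suc b) (φ m) (φ (1 + m)) (φ (2 + m))
    removed-column m b φ eq v = begin
      144 * split m (λ r s → split r λ j r′ → f j r′ s)
        ≡⟨ cong (144 *_) (trans (split-flip m (λ r s → split r λ j r′ → f j r′ s)) (split-assoc m (λ s j r′ → f j r′ s))) ⟩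
      144 * split m (λ j m′ → split m′ λ s r′ → f j r′ s)
        ≡⟨ trans (cong (144 *_) (split-cong m λ j m′ _ → split-flip m′ (λ s r′ → f j r′ s)))
             (sym (split-* m 144 (λ j m′ → split m′ (f j)))) ⟩
      split m (λ j m′ → 144 * split m′ (f j))
        ≡⟨ split-cong m by-induction ⟩
      split m (λ j m′ → weighted m′ b (0 + j) (φ m) (φ (1 + m)) (φ (2 + m)))
        ≡⟨ split-weighted m b 0 (φ m) (φ (1 + m)) (φ (2 + m)) ⟩
      φ m * K + (φ (1 + m) * M₁ + φ (2 + m) * M₂)
        ≡⟨ ring (φ m) (φ (1 + m)) (φ (2 + m)) K M₁ M₂ ⟩
      φ m * K + (φ (1 + m) * (M₁ + 0 * K) + φ (2 + m) * (M₂ + (0 * M₁ + 0 * K)))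
        ≡⟨ weighted-suc m b 0 (φ m) (φ (1 + m)) (φ (2 + m)) ⟨
      weighted m (suc b) 0 (φ m) (φ (1 + m)) (φ (2 + m))
        ≡⟨ weighted-flip m (suc b) 0 (φ m) (φ (1 + m)) (φ (2 + m)) ⟩
      weighted m 0 (suc b) (φ m) (φ (1 + m)) (φ (2 + m)) ∎
      where
      open ≡-Reasoning
      K  = Φ m (suc (b + 0)) ⟦ g₀ ⟧
      M₁ = Φ m (suc (b + 0)) (MG₁ b 0)
      M₂ = Φ m (suc (b + 0)) (MG₂ b 0)
      f : ℕ → ℕ → ℕ → ℕ
      f j r′ s = spannedCount n r′ s j b (λ e → φ (j + e))
      ring : ∀ x y z k p q → x * k + (y * p + z * q) ≡ x * k + (y * (p + 0 * k) + z * (q + (0 * p + 0 * k)))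
      ring = solve-∀
      by-induction : ∀ j m′ → j + m′ ≡ m →
        144 * split m′ (f j) ≡ weighted m′ b (0 + j) (φ m) (φ (1 + m)) (φ (2 + m))
      by-induction j m′ refl = trans
        (IH m′ j b (λ e → φ (j + e)) (trans (cong (_+ b) (+-comm m′ j)) eq)
          λ t → trans (cong φ (ring₂ j m′ t)) (v t))
        (trans (cong₂ (λ y z → weighted m′ j b (φ (j + m′)) (φ y) (φ z)) (+-suc j m′) (ring₄ j m′))
          (weighted-flip m′ j b (φ (j + m′)) (φ (1 + (j + m′))) (φ (2 + (j + m′)))))
        where
        ring₂ : ∀ j m t → j + (3 + m + t) ≡ 3 + (j + m) + t
        ring₂ = solve-∀
        ring₄ : ∀ j m → j + (2 + m) ≡ 2 + (j + m)
        ring₄ = solve-∀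

  Φ-0 : ∀ m c {h} → (∀ p i → h p i ≡ 0) → Φ m c h ≡ 0
  Φ-0 m c zeros = trans (Φ-cong m c zeros) (Φ-* m c 0 (λ _ _ → 0))

  -- Without marks there is no root for a forest, and the polynomials `G₁` and `G₂` vanish at a = b
  -- = 0.
  weighted-00 : ∀ m x y z → weighted (suc m) 0 0 x y z ≡ 0
  weighted-00 m x y z = trans
    (cong₂ (λ r (s , t) → x * r + (y * s + z * t))
      (cong (suc m *_) (Φ-0 m 1 λ { false i → refl ; true i → refl }))
      (cong₂ _,_ (Φ-0 (suc m) 0 λ _ _ → refl) (Φ-0 (suc m) 0 λ _ _ → refl)))
    (ring m x y z)
    where
    ring : ∀ m x y z → x * (suc m * 0) + (y * 0 + z * 0) ≡ 0
    ring = solve-∀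

  -- Induction on the number of vertices. A general weight `φ` is needed because each removal shifts
  -- its argument.
  spannedCount-formula : ∀ n m a b φ → m + a + b ≡ n → (∀ t → φ (3 + m + t) ≡ 0) →
    144 * split m (λ r s → spannedCount n r s a b φ) ≡ weighted m a b (φ m) (φ (1 + m)) (φ (2 + m))
  spannedCount-formula zero    zero zero zero φ refl v = ring (φ 0) (φ 1) (φ 2)
    where
    ring : ∀ x y z → 144 * x ≡ x * 144 + (y * 0 + z * 0)
    ring = solve-∀
  spannedCount-formula (suc n) (suc m) zero zero φ eq v = trans (cong (144 *_) (split-0 (suc m)))
    (sym (weighted-00 m (φ (1 + m)) (φ (2 + m)) (φ (3 + m))))
  spannedCount-formula (suc n) m zero    (suc b) φ eq v = removed-column n (spannedCount-formula n) m b φ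
    (suc-injective (trans (ring m b) eq)) v
    where
    ring : ∀ m b → suc (m + b) ≡ m + 0 + suc b
    ring = solve-∀
  spannedCount-formula (suc n) m (suc a) b       φ eq v = removed-row n (spannedCount-formula n) m a b φ
    (suc-injective (trans (sym (cong (_+ b) (+-suc m a))) eq)) v

  -- Asymptotics

  exactly-≡ : ∀ n → exactly n n ≡ 1
  exactly-≡ n with n ≟ n
  ... | yes _   = refl
  ... | no  n≢n with () ← n≢n refl

  exactly-≢ : ∀ {n e} → e ≢ n → exactly n e ≡ 0
  exactly-≢ {n} {e} e≢n = ind-no e≢n (e ≟ n)

  bicyclicSeries : Series
  bicyclicSeries = ⟦ g₂ 1 0 ⟧

  -- At a = 1 and b = 0 the falling factorials leave only u ≤ 1 and v = 0, and `g₂ 0 0` is zero.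
  weighted-10 : ∀ m → weighted m 1 0 0 0 1 ≡ Φ m 1 bicyclicSeries
  weighted-10 m = trans (+-identityʳ _) (Φ-cong m 1 entry)
    where
    ring : ∀ x → (1 * x + 0) + 0 ≡ x
    ring = solve-∀
    entry : ∀ p i → G₂ 1 0 p i ≡ ⟦ g₂ 1 0 ⟧ p i
    entry p i = ring′ (⟦ g₂ 1 0 ⟧ p i)
      where
      ring′ : ∀ x → 1 * (1 * 0 + 0) + (1 * (1 * x + 0) + 0) ≡ x
      ring′ = solve-∀

  144*split-bicyclicCount : ∀ m a b → a + b ≡ 1 →
    144 * split m (λ r s → bicyclicCount m r s a b) ≡ weighted m a b 0 0 1
  144*split-bicyclicCount m a b eq = trans
    (spannedCount-formula (suc m) m a b (exactly (2 + m))
      (trans (+-assoc m a b) (trans (cong (m +_) eq) (+-comm m 1)))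
      (λ t → exactly-≢ {2 + m} {3 + m + t} (>⇒≢ (m≤m+n (3 + m) t))))
    (cong₂ (λ x (y , z) → weighted m a b x y z) (exactly-≢ {2 + m} {m} (<⇒≢ (m<n+m m z<s)))
      (cong₂ _,_ (exactly-≢ {2 + m} {1 + m} (<⇒≢ (n<1+n (1 + m)))) (exactly-≡ (2 + m))))

  -- The factor 2 arises because a root on either side contributes equally.
  144*N-bi-total : ∀ m → 144 * N-bi-total (suc m) (ℤ.+ 2) ≡ 2 * Φ m 1 bicyclicSeries
  144*N-bi-total m = begin
    144 * N-bi-total (suc m) (ℤ.+ 2)
      ≡⟨ trans (cong (144 *_) (N-bi-total≡split m)) (*-distribˡ-+ 144 (split m (λ r s → bicyclicCount m r s 1 0)) _) ⟩
    144 * split m (λ r s → bicyclicCount m r s 1 0) + 144 * split m (λ r s → bicyclicCount m r s 0 1)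
      ≡⟨ cong₂ _+_ (144*split-bicyclicCount m 1 0 refl)
           (trans (144*split-bicyclicCount m 0 1 refl) (weighted-flip m 0 1 0 0 1)) ⟩
    weighted m 1 0 0 0 1 + weighted m 1 0 0 0 1
      ≡⟨ cong₂ _+_ (weighted-10 m) (trans (weighted-10 m) (sym (+-identityʳ _))) ⟩
    2 * Φ m 1 bicyclicSeries ∎
    where open ≡-Reasoning

  -- The functional Φ m c with the coefficient of T^l given as a function of L = c + l.
  Φᴸ : ℕ → ℕ → (ℕ → ℕ) → ℕ
  Φᴸ zero    c H = H c
  Φᴸ (suc m) c H = H c * forests (suc m) c + suc m * Φᴸ m (suc c) H

  -- The same for m! [x^m] h(T) exp(cT) / (1 - T).
  Ψ : ℕ → ℕ → (ℕ → ℕ) → ℕ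
  Ψ zero    c H = H c
  Ψ (suc m) c H = H c * (suc m + c) ^ suc m + suc m * Ψ m (suc c) H

  atᴸ : ℕ → (ℕ → ℕ) → Series
  atᴸ c H false i = H (c + i * 2)
  atᴸ c H true  i = H (c + suc (i * 2))

  tail-atᴸ : ∀ c H → tail (atᴸ c H) ≗ˢ atᴸ (suc c) H
  tail-atᴸ c H false i = cong H (+-suc c (i * 2))
  tail-atᴸ c H true  i = cong H (+-suc c (suc (i * 2)))

  Φ-atᴸ : ∀ m c H → Φ m c (atᴸ c H) ≡ Φᴸ m c H
  Φ-atᴸ zero    c H = cong H (+-identityʳ c)
  Φ-atᴸ (suc m) c H = cong₂ (λ x y → x * forests (suc m) c + suc m * y) (cong H (+-identityʳ c))
    (trans (Φ-cong m (suc c) (tail-atᴸ c H)) (Φ-atᴸ m (suc c) H))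

  Φ-mono : ∀ m c {h h′ : Series} → (∀ p i → h p i ≤ h′ p i) → Φ m c h ≤ Φ m c h′
  Φ-mono zero    c le = le false 0
  Φ-mono (suc m) c {h} {h′} le = +-mono-≤ (*-monoˡ-≤ (forests (suc m) c) (le false 0)) (*-monoʳ-≤ (suc m) (Φ-mono m (suc c) tail-le))
    where
    tail-le : ∀ p i → tail h p i ≤ tail h′ p i
    tail-le false i = le true i
    tail-le true  i = le false (suc i)

  -- Summation by parts: the weight of L in `Φᴸ` is the difference of the weights of L and L + 1 in
  -- `Ψ`. The boundary term involves `H c`.
  Φᴸ-telescope : ∀ m c (H D : ℕ → ℕ) → (∀ L → H (suc L) ≡ H L + D (suc L)) →
    Φᴸ m (suc c) H ≡ Ψ m (suc c) D + H c * (m + suc c) ^ m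
  Φᴸ-telescope zero    c H D step = trans (step c) (trans (+-comm (H c) _) (cong (D (suc c) +_) (sym (*-identityʳ (H c)))))
  Φᴸ-telescope (suc m) c H D step = begin
    H (suc c) * (suc c * N ^ m) + suc m * Φᴸ m (2 + c) H
      ≡⟨ cong (λ x → H (suc c) * (suc c * N ^ m) + suc m * x) (Φᴸ-telescope m (suc c) H D step) ⟩
    H (suc c) * (suc c * N ^ m) + suc m * (Ψ m (2 + c) D + H (suc c) * (m + (2 + c)) ^ m)
      ≡⟨ cong (λ M → H (suc c) * (suc c * N ^ m) + suc m * (Ψ m (2 + c) D + H (suc c) * M ^ m)) (+-suc m (suc c)) ⟩
    H (suc c) * (suc c * N ^ m) + suc m * (Ψ m (2 + c) D + H (suc c) * N ^ m)
      ≡⟨ ring (H (suc c)) m c (N ^ m) (Ψ m (2 + c) D) ⟩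
    H (suc c) * (N * N ^ m) + suc m * Ψ m (2 + c) D
      ≡⟨ cong (λ x → x * (N * N ^ m) + suc m * Ψ m (2 + c) D) (step c) ⟩
    (H c + D (suc c)) * (N * N ^ m) + suc m * Ψ m (2 + c) D
      ≡⟨ ring′ (H c) (D (suc c)) (N * N ^ m) (suc m * Ψ m (2 + c) D) ⟩
    D (suc c) * (N * N ^ m) + suc m * Ψ m (2 + c) D + H c * (N * N ^ m) ∎
    where
    open ≡-Reasoning
    N = suc m + suc c
    ring : ∀ h m c x y → h * (suc c * x) + suc m * (y + h * x) ≡ h * ((suc m + suc c) * x) + suc m * y
    ring = solve-∀
    ring′ : ∀ h d x y → (h + d) * x + y ≡ d * x + y + h * x
    ring′ = solve-∀

  -- The weight of L in `Φᴸ` is L / (m + c) times its weight in `Ψ`, and m + c is constant along the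
  -- recursion.
  Ψ-L* : ∀ m c H → Ψ m c (λ L → L * H L) ≡ (m + c) * Φᴸ m c H
  Ψ-L* zero    c H = refl
  Ψ-L* (suc m) c H = begin
    c * H c * (N * N ^ m) + suc m * Ψ m (suc c) (λ L → L * H L)
      ≡⟨ cong (λ x → c * H c * (N * N ^ m) + suc m * x) (trans (Ψ-L* m (suc c) H) (cong (_* Φᴸ m (suc c) H) (+-suc m c))) ⟩
    c * H c * (N * N ^ m) + suc m * (N * Φᴸ m (suc c) H)
      ≡⟨ ring c (H c) N (N ^ m) m (Φᴸ m (suc c) H) ⟩
    N * (H c * (c * N ^ m) + suc m * Φᴸ m (suc c) H) ∎
    where
    open ≡-Reasoning
    N = suc m + c
    ring : ∀ c h N x m y → c * h * (N * x) + suc m * (N * y) ≡ N * (h * (c * x) + suc m * y)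
    ring = solve-∀

  Ψ-+ : ∀ m c H H′ → Ψ m c (λ L → H L + H′ L) ≡ Ψ m c H + Ψ m c H′
  Ψ-+ zero    c H H′ = refl
  Ψ-+ (suc m) c H H′ = trans (cong (λ x → (H c + H′ c) * (suc m + c) ^ suc m + suc m * x) (Ψ-+ m (suc c) H H′))
    (ring (H c) (H′ c) ((suc m + c) ^ suc m) m (Ψ m (suc c) H) (Ψ m (suc c) H′))
    where
    ring : ∀ h k x m y z → (h + k) * x + suc m * (y + z) ≡ (h * x + suc m * y) + (k * x + suc m * z)
    ring = solve-∀

  Ψ-constant : ∀ m c k → Ψ m c (λ _ → k) ≡ k * Ψ m c (λ _ → 1)
  Ψ-constant zero    c k = sym (*-identityʳ k)
  Ψ-constant (suc m) c k = trans (cong (λ x → k * (suc m + c) ^ suc m + suc m * x) (Ψ-constant m (suc c) k))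
    (ring k ((suc m + c) ^ suc m) m (Ψ m (suc c) (λ _ → 1)))
    where
    ring : ∀ k x m y → k * x + suc m * (k * y) ≡ k * (1 * x + suc m * y)
    ring = solve-∀

  -- Rising factorials are preferred to powers because their difference at L has the factor L that
  -- `Ψ-L*` absorbs.
  rising₃ rising₄ : ℕ → ℕ
  rising₃ L = L * ((1 + L) * (2 + L))
  rising₄ L = L * ((1 + L) * ((2 + L) * (3 + L)))

  module _ (m : ℕ) where

    private
      N = m + 1
      -- This is `N ^ m` times Ramanujan's function 1 + (N-1)/N + (N-1)(N-2)/N^2 + ..., which grows
      -- like the square root of N.
      Q = Ψ m 1 (λ _ → 1)

    Φᴸ-constant : ∀ k → Φᴸ m 1 (λ _ → k) ≡ k * N ^ m
    Φᴸ-constant k = trans (Φᴸ-telescope m 0 (λ _ → k) (λ _ → 0) (λ _ → sym (+-identityʳ k)))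
      (cong (_+ k * N ^ m) (Ψ-constant m 1 0))

    Φᴸ-rising₃ : Φᴸ m 1 rising₃ ≡ N * (3 * Q + 3 * N ^ m)
    Φᴸ-rising₃ = begin
      Φᴸ m 1 rising₃
        ≡⟨ Φᴸ-telescope m 0 rising₃ (λ L → L * (3 * (1 + L))) step ⟩
      Ψ m 1 (λ L → L * (3 * (1 + L))) + 0
        ≡⟨ trans (+-identityʳ _) (Ψ-L* m 1 (λ L → 3 * (1 + L))) ⟩
      N * Φᴸ m 1 (λ L → 3 * (1 + L))
        ≡⟨ cong (N *_) (trans (Φᴸ-telescope m 0 (λ L → 3 * (1 + L)) (λ _ → 3) step′) (cong (_+ 3 * N ^ m) (Ψ-constant m 1 3))) ⟩
      N * (3 * Q + 3 * N ^ m) ∎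
      where
      open ≡-Reasoning
      step : ∀ L → (1 + L) * ((2 + L) * (3 + L)) ≡ L * ((1 + L) * (2 + L)) + (1 + L) * (3 * (2 + L))
      step = solve-∀
      step′ : ∀ L → 3 * (2 + L) ≡ 3 * (1 + L) + 3
      step′ = solve-∀

    Φᴸ-rising₄ : Φᴸ m 1 rising₄ ≡ N * (8 * N * N ^ m + 8 * Q + 8 * N ^ m)
    Φᴸ-rising₄ = begin
      Φᴸ m 1 rising₄
        ≡⟨ Φᴸ-telescope m 0 rising₄ (λ L → L * (4 * ((1 + L) * (2 + L)))) step ⟩
      Ψ m 1 (λ L → L * (4 * ((1 + L) * (2 + L)))) + 0
        ≡⟨ trans (+-identityʳ _) (Ψ-L* m 1 (λ L → 4 * ((1 + L) * (2 + L)))) ⟩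
      N * Φᴸ m 1 (λ L → 4 * ((1 + L) * (2 + L)))
        ≡⟨ cong (N *_) (Φᴸ-telescope m 0 (λ L → 4 * ((1 + L) * (2 + L))) (λ L → L * 8 + 8) step′) ⟩
      N * (Ψ m 1 (λ L → L * 8 + 8) + 8 * N ^ m)
        ≡⟨ cong (λ x → N * (x + 8 * N ^ m)) (trans (Ψ-+ m 1 (λ L → L * 8) (λ _ → 8))
             (cong₂ _+_ (trans (Ψ-L* m 1 (λ _ → 8)) (cong (N *_) (Φᴸ-constant 8))) (Ψ-constant m 1 8))) ⟩
      N * (N * (8 * N ^ m) + 8 * Q + 8 * N ^ m)
        ≡⟨ ring N (N ^ m) Q ⟩
      N * (8 * N * N ^ m + 8 * Q + 8 * N ^ m) ∎
      where
      open ≡-Reasoning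
      step : ∀ L → (1 + L) * ((2 + L) * ((3 + L) * (4 + L))) ≡
        L * ((1 + L) * ((2 + L) * (3 + L))) + (1 + L) * (4 * ((2 + L) * (3 + L)))
      step = solve-∀
      step′ : ∀ L → 4 * ((2 + L) * (3 + L)) ≡ 4 * ((1 + L) * (2 + L)) + ((1 + L) * 8 + 8)
      step′ = solve-∀
      ring : ∀ N x q → N * (N * (8 * x) + 8 * q + 8 * x) ≡ N * (8 * N * x + 8 * q + 8 * x)
      ring = solve-∀

  -- Coefficientwise comparison with rising factorials

  ≤-by : ∀ {x y} d → x + d ≡ y → x ≤ y
  ≤-by {x} d refl = m≤m+n x d

  infixr 6 _⊠ₚ_

  _⊠ₚ_ : List ℕ → List ℕ → List ℕ
  []      ⊠ₚ q = []
  (c ∷ p) ⊠ₚ q = List.map (c *_) q ⊞ₚ (0 ∷ p ⊠ₚ q)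

  eval-⊠ₚ : ∀ p q i → eval (p ⊠ₚ q) i ≡ eval p i * eval q i
  eval-⊠ₚ []      q i = refl
  eval-⊠ₚ (c ∷ p) q i = begin
    eval (List.map (c *_) q ⊞ₚ (0 ∷ p ⊠ₚ q)) i      ≡⟨ eval-⊞ₚ (List.map (c *_) q) (0 ∷ p ⊠ₚ q) i ⟩
    eval (List.map (c *_) q) i + i * eval (p ⊠ₚ q) i ≡⟨ cong₂ (λ x y → x + i * y) (at-⊠ c (poly q) i) (eval-⊠ₚ p q i) ⟩
    c * eval q i + i * (eval p i * eval q i)        ≡⟨ ring c i (eval p i) (eval q i) ⟩
    (c + i * eval p i) * eval q i                   ∎
    where
    open ≡-Reasoning
    ring : ∀ c i x y → c * y + i * (x * y) ≡ (c + i * x) * y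
    ring = solve-∀

  plus : ℕ → List ℕ → List ℕ
  plus k ℓ = (k ∷ []) ⊞ₚ ℓ

  eval-plus : ∀ k ℓ i → eval (plus k ℓ) i ≡ k + eval ℓ i
  eval-plus k ℓ i = trans (eval-⊞ₚ (k ∷ []) ℓ i)
    (cong (_+ eval ℓ i) (trans (cong (k +_) (*-zeroʳ i)) (+-identityʳ k)))

  cubic quartic : List ℕ → List ℕ
  cubic   ℓ = ℓ ⊠ₚ plus 1 ℓ ⊠ₚ plus 2 ℓ
  quartic ℓ = ℓ ⊠ₚ plus 1 ℓ ⊠ₚ plus 2 ℓ ⊠ₚ plus 3 ℓ

  eval-cubic : ∀ ℓ i → eval (cubic ℓ) i ≡ rising₃ (eval ℓ i)
  eval-cubic ℓ i = trans (eval-⊠ₚ ℓ (plus 1 ℓ ⊠ₚ plus 2 ℓ) i) (cong (eval ℓ i *_)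
    (trans (eval-⊠ₚ (plus 1 ℓ) (plus 2 ℓ) i) (cong₂ _*_ (eval-plus 1 ℓ i) (eval-plus 2 ℓ i))))

  eval-quartic : ∀ ℓ i → eval (quartic ℓ) i ≡ rising₄ (eval ℓ i)
  eval-quartic ℓ i = trans (eval-⊠ₚ ℓ (plus 1 ℓ ⊠ₚ plus 2 ℓ ⊠ₚ plus 3 ℓ) i) (cong (eval ℓ i *_)
    (trans (eval-⊠ₚ (plus 1 ℓ) (plus 2 ℓ ⊠ₚ plus 3 ℓ) i) (cong₂ _*_ (eval-plus 1 ℓ i)
      (trans (eval-⊠ₚ (plus 2 ℓ) (plus 3 ℓ) i) (cong₂ _*_ (eval-plus 2 ℓ i) (eval-plus 3 ℓ i))))))

  module _ (i : ℕ) (ℓ p d : List ℕ) {h L : ℕ} (h≡ : h ≡ eval p i) (L≡ : L ≡ eval ℓ i) where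

    private
      scaled : ∀ k {x} q → x ≡ eval q i → eval (List.map (k *_) q) i ≡ k * x
      scaled k q eq = trans (at-⊠ k (poly q) i) (cong (k *_) (sym eq))
      R₃≡ : rising₃ L ≡ eval (cubic ℓ) i
      R₃≡ = trans (cong rising₃ L≡) (sym (eval-cubic ℓ i))
      R₄≡ : rising₄ L ≡ eval (quartic ℓ) i
      R₄≡ = trans (cong rising₄ L≡) (sym (eval-quartic ℓ i))

    -- The slack `d` is a polynomial with natural coefficients, hence nonnegative at every `i`. The
    -- factors match the leading terms: 15 i^4 in `bicyclicSeries` against (2 i)^4 = 16 i^4.
    16h≤15R₄ : List.map (16 *_) p ⊞ₚ d ≡ List.map (15 *_) (quartic ℓ) → 16 * h ≤ 15 * rising₄ L
    16h≤15R₄ eq = ≤-by (eval d i) (begin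
      16 * h + eval d i                       ≡⟨ cong (_+ eval d i) (scaled 16 p h≡) ⟨
      eval (List.map (16 *_) p) i + eval d i  ≡⟨ eval-⊞ₚ (List.map (16 *_) p) d i ⟨
      eval (List.map (16 *_) p ⊞ₚ d) i        ≡⟨ cong (λ q → eval q i) eq ⟩
      eval (List.map (15 *_) (quartic ℓ)) i   ≡⟨ scaled 15 (quartic ℓ) R₄≡ ⟩
      15 * rising₄ L                          ∎)
      where open ≡-Reasoning

    -- The constant 176 cancels the cubic terms: 176 (2 i)^3 = 1408 i^3, and 1408 is the cubic
    -- coefficient of the slack in the upper bound for either parity.
    15R₄≤16h+176R₃ : List.map (15 *_) (quartic ℓ) ⊞ₚ d ≡ List.map (16 *_) p ⊞ₚ List.map (176 *_) (cubic ℓ) →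
      15 * rising₄ L ≤ 16 * h + 176 * rising₃ L
    15R₄≤16h+176R₃ eq = ≤-by (eval d i) (begin
      15 * rising₄ L + eval d i
        ≡⟨ cong (_+ eval d i) (scaled 15 (quartic ℓ) R₄≡) ⟨
      eval (List.map (15 *_) (quartic ℓ)) i + eval d i
        ≡⟨ eval-⊞ₚ (List.map (15 *_) (quartic ℓ)) d i ⟨
      eval (List.map (15 *_) (quartic ℓ) ⊞ₚ d) i
        ≡⟨ cong (λ q → eval q i) eq ⟩
      eval (List.map (16 *_) p ⊞ₚ List.map (176 *_) (cubic ℓ)) i
        ≡⟨ eval-⊞ₚ (List.map (16 *_) p) (List.map (176 *_) (cubic ℓ)) i ⟩
      eval (List.map (16 *_) p) i + eval (List.map (176 *_) (cubic ℓ)) i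
        ≡⟨ cong₂ _+_ (scaled 16 p h≡) (scaled 176 (cubic ℓ) R₃≡) ⟩
      16 * h + 176 * rising₃ L ∎)
      where open ≡-Reasoning

  even-L : ∀ i → 1 + suc (suc i) * 2 ≡ eval (5 ∷ 2 ∷ []) i
  even-L = ring
    where
    ring : ∀ i → 5 + i * 2 ≡ 5 + i * (2 + i * 0)
    ring = solve-∀

  odd-L : ∀ i → 1 + suc (suc i * 2) ≡ eval (4 ∷ 2 ∷ []) i
  odd-L = ring
    where
    ring : ∀ i → 4 + i * 2 ≡ 4 + i * (2 + i * 0)
    ring = solve-∀

  evenPart oddPart : List ℕ
  evenPart = 60 ∷ 220 ∷ 252 ∷ 107 ∷ 15 ∷ []
  oddPart  = 0 ∷ 61 ∷ 123 ∷ 77 ∷ 15 ∷ []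

  bicyclicSeries-upper : ∀ p i → 16 * bicyclicSeries p i ≤ 15 * atᴸ 1 rising₄ p i
  bicyclicSeries-upper false 0 = z≤n
  bicyclicSeries-upper false 1 = z≤n
  bicyclicSeries-upper false (suc (suc i)) =
    16h≤15R₄ i (5 ∷ 2 ∷ []) evenPart (24240 ∷ 28460 ∷ 11028 ∷ 1408 ∷ [])
      {bicyclicSeries false (suc (suc i))} {1 + suc (suc i) * 2} refl (even-L i) refl
  bicyclicSeries-upper true 0 = z≤n
  bicyclicSeries-upper true (suc i) =
    16h≤15R₄ i (4 ∷ 2 ∷ []) oddPart (12600 ∷ 18164 ∷ 8772 ∷ 1408 ∷ [])
      {bicyclicSeries true (suc i)} {1 + suc (suc i * 2)} refl (odd-L i) refl

  bicyclicSeries-lower : ∀ p i → 15 * atᴸ 1 rising₄ p i ≤ 16 * bicyclicSeries p i + 176 * atᴸ 1 rising₃ p i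
  bicyclicSeries-lower false 0 = ≤-by 696 refl
  bicyclicSeries-lower false 1 = ≤-by 5160 refl
  bicyclicSeries-lower false (suc (suc i)) =
    15R₄≤16h+176R₃ i (5 ∷ 2 ∷ []) evenPart (12720 ∷ 9204 ∷ 1644 ∷ [])
      {bicyclicSeries false (suc (suc i))} {1 + suc (suc i) * 2} refl (even-L i) refl
  bicyclicSeries-lower true 0 = ≤-by 2424 refl
  bicyclicSeries-lower true (suc i) =
    15R₄≤16h+176R₃ i (4 ∷ 2 ∷ []) oddPart (8520 ∷ 7884 ∷ 1788 ∷ [])
      {bicyclicSeries true (suc i)} {1 + suc (suc i * 2)} refl (odd-L i) refl

  -- Two-sided bounds for the count

  module _ (m : ℕ) where

    private
      N = m + 1
      Q = Ψ m 1 (λ _ → 1)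
      T = N-bi-total (suc m) (ℤ.+ 2)
      h = Φ m 1 bicyclicSeries

    16*Φ-upper : 16 * h ≤ 15 * (N * (8 * N * N ^ m + 8 * Q + 8 * N ^ m))
    16*Φ-upper = begin
      16 * h                                ≡⟨ Φ-* m 1 16 bicyclicSeries ⟨
      Φ m 1 (λ p i → 16 * bicyclicSeries p i) ≤⟨ Φ-mono m 1 bicyclicSeries-upper ⟩
      Φ m 1 (λ p i → 15 * atᴸ 1 rising₄ p i) ≡⟨ Φ-* m 1 15 (atᴸ 1 rising₄) ⟩
      15 * Φ m 1 (atᴸ 1 rising₄)            ≡⟨ cong (15 *_) (trans (Φ-atᴸ m 1 rising₄) (Φᴸ-rising₄ m)) ⟩
      15 * (N * (8 * N * N ^ m + 8 * Q + 8 * N ^ m)) ∎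
      where open ≤-Reasoning

    16*Φ-lower : 15 * (N * (8 * N * N ^ m + 8 * Q + 8 * N ^ m)) ≤ 16 * h + 176 * (N * (3 * Q + 3 * N ^ m))
    16*Φ-lower = begin
      15 * (N * (8 * N * N ^ m + 8 * Q + 8 * N ^ m))
        ≡⟨ cong (15 *_) (trans (Φ-atᴸ m 1 rising₄) (Φᴸ-rising₄ m)) ⟨
      15 * Φ m 1 (atᴸ 1 rising₄)
        ≡⟨ Φ-* m 1 15 (atᴸ 1 rising₄) ⟨
      Φ m 1 (λ p i → 15 * atᴸ 1 rising₄ p i)
        ≤⟨ Φ-mono m 1 bicyclicSeries-lower ⟩
      Φ m 1 (λ p i → 16 * bicyclicSeries p i + 176 * atᴸ 1 rising₃ p i)
        ≡⟨ trans (Φ-+ m 1 (λ p i → 16 * bicyclicSeries p i) (λ p i → 176 * atᴸ 1 rising₃ p i))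
             (cong₂ _+_ (Φ-* m 1 16 bicyclicSeries) (Φ-* m 1 176 (atᴸ 1 rising₃))) ⟩
      16 * h + 176 * Φ m 1 (atᴸ 1 rising₃)
        ≡⟨ cong (λ x → 16 * h + 176 * x) (trans (Φ-atᴸ m 1 rising₃) (Φᴸ-rising₃ m)) ⟩
      16 * h + 176 * (N * (3 * Q + 3 * N ^ m)) ∎
      where open ≤-Reasoning

    -- The lower bound dictates 22, as 2 * 176 * 3 = 48 * 22; the upper bound has only 2 * 15 * 8 =
    -- 240 in place of 48 * 22.
    error : ℕ
    error = 22 * (N * (Q + N ^ m))

    N-bi-total-upper : 48 * T ≤ 5 * (N * (N * N ^ m)) + error
    -- Since 48 * 48 = 16 * 144, this factor fits both `144*N-bi-total` and `16*Φ-upper`.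
    N-bi-total-upper = *-cancelˡ-≤ 48 (begin
      48 * (48 * T)      ≡⟨ ring T ⟩
      16 * (144 * T)     ≡⟨ cong (16 *_) (144*N-bi-total m) ⟩
      16 * (2 * h)       ≡⟨ ring₁ h ⟩
      2 * (16 * h)       ≤⟨ *-monoʳ-≤ 2 16*Φ-upper ⟩
      2 * (15 * (N * (8 * N * N ^ m + 8 * Q + 8 * N ^ m)))
                         ≤⟨ ≤-by (816 * (N * (Q + N ^ m))) (ring₂ N (N ^ m) Q) ⟩
      48 * (5 * (N * (N * N ^ m)) + error) ∎)
      where
      open ≤-Reasoning
      ring : ∀ t → 48 * (48 * t) ≡ 16 * (144 * t)
      ring = solve-∀
      ring₁ : ∀ t → 16 * (2 * t) ≡ 2 * (16 * t)
      ring₁ = solve-∀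
      ring₂ : ∀ N x q → 2 * (15 * (N * (8 * N * x + 8 * q + 8 * x))) + 816 * (N * (q + x)) ≡
        48 * (5 * (N * (N * x)) + 22 * (N * (q + x)))
      ring₂ = solve-∀

    N-bi-total-lower : 5 * (N * (N * N ^ m)) ≤ 48 * T + error
    N-bi-total-lower = *-cancelˡ-≤ 48 (begin
      48 * (5 * (N * (N * N ^ m)))
        ≤⟨ ≤-by (240 * (N * (Q + N ^ m))) (ring N (N ^ m) Q) ⟩
      2 * (15 * (N * (8 * N * N ^ m + 8 * Q + 8 * N ^ m)))
        ≤⟨ *-monoʳ-≤ 2 16*Φ-lower ⟩
      2 * (16 * h + 176 * (N * (3 * Q + 3 * N ^ m)))
        ≡⟨ ring₁ h N (N ^ m) Q ⟩
      16 * (2 * h) + 48 * error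
        ≡⟨ cong (λ x → 16 * x + 48 * error) (144*N-bi-total m) ⟨
      16 * (144 * T) + 48 * error
        ≡⟨ ring₂ T error ⟩
      48 * (48 * T + error) ∎)
      where
      open ≤-Reasoning
      ring : ∀ N x q → 48 * (5 * (N * (N * x))) + 240 * (N * (q + x)) ≡ 2 * (15 * (N * (8 * N * x + 8 * q + 8 * x)))
      ring = solve-∀
      ring₁ : ∀ h N x q → 2 * (16 * h + 176 * (N * (3 * q + 3 * x))) ≡ 16 * (2 * h) + 48 * (22 * (N * (q + x)))
      ring₁ = solve-∀
      ring₂ : ∀ t e → 16 * (144 * t) + 48 * e ≡ 48 * (48 * t + e)
      ring₂ = solve-∀

  -- At most k of the values of L are below k, and the others satisfy k ≤ L.
  Ψ-k≤ : ∀ m c k → Ψ m c (λ _ → k) ≤ k * (k ∸ c) * (m + c) ^ m + Ψ m c (λ L → L * 1)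
  Ψ-k≤ zero    c k with k ≤? c
  ... | yes k≤c = ≤-trans k≤c (≤-trans (≤-reflexive (sym (*-identityʳ c))) (m≤n+m (c * 1) _))
  ... | no  k≰c with d , refl ← m≤n⇒∃[o]m+o≡n (≰⇒> k≰c) = ≤-trans
    (≤-trans (m≤m*n (suc c + d) (suc d)) (≤-reflexive (trans (cong ((suc c + d) *_) (sym gap)) (sym (*-identityʳ _)))))
    (m≤m+n _ (c * 1))
    where
    gap : suc c + d ∸ c ≡ suc d
    gap = trans (cong (_∸ c) (sym (+-suc c d))) (m+n∸m≡n c (suc d))
  Ψ-k≤ (suc m) c k = begin
    k * (N * N ^ m) + suc m * Ψ m (suc c) (λ _ → k)
      ≤⟨ +-monoʳ-≤ (k * (N * N ^ m)) (*-monoʳ-≤ (suc m) (Ψ-k≤ m (suc c) k)) ⟩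
    k * (N * N ^ m) + suc m * (k * (k ∸ suc c) * (m + suc c) ^ m + Ψ′)
      ≡⟨ cong (λ M → k * (N * N ^ m) + suc m * (k * (k ∸ suc c) * M ^ m + Ψ′)) (+-suc m c) ⟩
    k * (N * N ^ m) + suc m * (k * (k ∸ suc c) * N ^ m + Ψ′)
      ≤⟨ step ⟩
    k * (k ∸ c) * (N * N ^ m) + (c * 1 * (N * N ^ m) + suc m * Ψ′) ∎
    where
    open ≤-Reasoning
    N = suc m + c
    Ψ′ = Ψ m (suc c) (λ L → L * 1)
    step : k * (N * N ^ m) + suc m * (k * (k ∸ suc c) * N ^ m + Ψ′) ≤
      k * (k ∸ c) * (N * N ^ m) + (c * 1 * (N * N ^ m) + suc m * Ψ′)
    step with k ≤? c
    ... | yes k≤c = begin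
      k * (N * N ^ m) + suc m * (k * (k ∸ suc c) * N ^ m + Ψ′)
        ≡⟨ cong (λ d → k * (N * N ^ m) + suc m * (k * d * N ^ m + Ψ′)) (m≤n⇒m∸n≡0 (m≤n⇒m≤1+n k≤c)) ⟩
      k * (N * N ^ m) + suc m * (k * 0 * N ^ m + Ψ′)
        ≤⟨ +-monoˡ-≤ (suc m * (k * 0 * N ^ m + Ψ′)) (*-monoˡ-≤ (N * N ^ m) k≤c) ⟩
      c * (N * N ^ m) + suc m * (k * 0 * N ^ m + Ψ′)
        ≡⟨ ring c (N * N ^ m) m k (N ^ m) Ψ′ ⟩
      c * 1 * (N * N ^ m) + suc m * Ψ′
        ≤⟨ m≤n+m _ (k * (k ∸ c) * (N * N ^ m)) ⟩
      k * (k ∸ c) * (N * N ^ m) + (c * 1 * (N * N ^ m) + suc m * Ψ′) ∎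
      where
      ring : ∀ c y m k x z → c * y + suc m * (k * 0 * x + z) ≡ c * 1 * y + suc m * z
      ring = solve-∀
    ... | no k≰c with d , refl ← m≤n⇒∃[o]m+o≡n (≰⇒> k≰c) = begin
      k * (N * N ^ m) + suc m * (k * (k ∸ suc c) * N ^ m + Ψ′)
        ≡⟨ cong (λ d → k * (N * N ^ m) + suc m * (k * d * N ^ m + Ψ′)) (m+n∸m≡n (suc c) d) ⟩
      k * (N * N ^ m) + suc m * (k * d * N ^ m + Ψ′)
        ≤⟨ ≤-by (c * k * d * N ^ m + c * 1 * (N * N ^ m)) (ring k c m d (N ^ m) Ψ′) ⟩
      k * suc d * (N * N ^ m) + (c * 1 * (N * N ^ m) + suc m * Ψ′)
        ≡⟨ cong (λ e → k * e * (N * N ^ m) + (c * 1 * (N * N ^ m) + suc m * Ψ′))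
             (trans (cong (_∸ c) (sym (+-suc c d))) (m+n∸m≡n c (suc d))) ⟨
      k * (k ∸ c) * (N * N ^ m) + (c * 1 * (N * N ^ m) + suc m * Ψ′) ∎
      where
      ring : ∀ k c m d x z → k * ((suc m + c) * x) + suc m * (k * d * x + z) + (c * k * d * x + c * 1 * ((suc m + c) * x)) ≡
        k * suc d * ((suc m + c) * x) + (c * 1 * ((suc m + c) * x) + suc m * z)
      ring = solve-∀

  -- The sum of L t_L is exactly N, so `Q` is at most (k + N / k) N^m for every positive k. This
  -- shows that it is of lower order without any estimate of t_L.
  k*Ψ₁≤ : ∀ m k → k * Ψ m 1 (λ _ → 1) ≤ k * k * (m + 1) ^ m + (m + 1) * (m + 1) ^ m
  k*Ψ₁≤ m k = begin
    k * Ψ m 1 (λ _ → 1)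
      ≡⟨ Ψ-constant m 1 k ⟨
    Ψ m 1 (λ _ → k)
      ≤⟨ Ψ-k≤ m 1 k ⟩
    k * (k ∸ 1) * (m + 1) ^ m + Ψ m 1 (λ L → L * 1)
      ≤⟨ +-mono-≤ (*-monoˡ-≤ ((m + 1) ^ m) (*-monoʳ-≤ k (m∸n≤m k 1)))
           (≤-reflexive (trans (Ψ-L* m 1 (λ _ → 1)) (cong ((m + 1) *_) (trans (Φᴸ-constant m 1) (*-identityˡ _))))) ⟩
    k * k * (m + 1) ^ m + (m + 1) * (m + 1) ^ m ∎
    where open ≤-Reasoning

  -- Under k * k ≤ N each of three summands is at most N N^m, whence 66 = 3 * 22.
  k*error≤ : ∀ m k → k * k ≤ m + 1 → k * error m ≤ 66 * ((m + 1) * ((m + 1) * (m + 1) ^ m))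
  k*error≤ m k k²≤N = begin
    k * (22 * (N * (Q + X)))
      ≡⟨ ring k N Q X ⟩
    22 * (N * (k * Q + k * X))
      ≤⟨ *-monoʳ-≤ 22 (*-monoʳ-≤ N (+-mono-≤ (k*Ψ₁≤ m k) (*-monoˡ-≤ X (k≤k² k)))) ⟩
    22 * (N * (k * k * X + N * X + k * k * X))
      ≤⟨ *-monoʳ-≤ 22 (*-monoʳ-≤ N (+-mono-≤ (+-monoˡ-≤ (N * X) (*-monoˡ-≤ X k²≤N)) (*-monoˡ-≤ X k²≤N))) ⟩
    22 * (N * (N * X + N * X + N * X))
      ≡⟨ ring′ N X ⟩
    66 * (N * (N * X)) ∎
    where
    open ≤-Reasoning
    N = m + 1
    X = N ^ m
    Q = Ψ m 1 (λ _ → 1)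
    k≤k² : ∀ k → k ≤ k * k
    k≤k² zero    = z≤n
    k≤k² (suc k) = m≤m*n (suc k) (suc k)
    ring : ∀ k N q x → k * (22 * (N * (q + x))) ≡ 22 * (N * (k * q + k * x))
    ring = solve-∀
    ring′ : ∀ N x → 22 * (N * (N * x + N * x + N * x)) ≡ 66 * (N * (N * x))
    ring′ = solve-∀

  -- The limit

  ∣⊖∣≤ : ∀ {x y e} → x ≤ y + e → y ≤ x + e → ℤ.∣ ℤ.+ x ℤ.- ℤ.+ y ∣ ≤ e
  ∣⊖∣≤ {x} {y} {e} x≤ y≤ with ≤-total x y
  ... | inj₁ x≤y = subst (_≤ e) (sym (trans (cong ℤ.∣_∣ (ℤ.m-n≡m⊖n x y)) (ℤ.∣⊖∣-≤ x≤y))) (m≤n+o⇒m∸n≤o y x y≤)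
  ... | inj₂ y≤x = subst (_≤ e)
    (sym (trans (cong ℤ.∣_∣ (ℤ.m-n≡m⊖n x y)) (trans (ℤ.∣m⊖n∣≡∣n⊖m∣ x y) (ℤ.∣⊖∣-≤ y≤x)))) (m≤n+o⇒m∸n≤o x y x≤)

  target : ℕ → ℚ
  target B = (ℤ.+ 5 ℚ./ 48) ℚ.* fromℕ B

  target-nonZero : ∀ B .{{_ : NonZero B}} → ℚ.NonZero (target B)
  target-nonZero B = ℚ.pos⇒nonZero (target B) {{ℚ.pos*pos⇒pos (ℤ.+ 5 ℚ./ 48) (fromℕ B) {{ℚ.normalize-pos B 1}}}}

  module _ (T d B : ℕ) (D≡5B : suc d ≡ 5 * B) where

    private
      -- This is 48 T / (5 B): `mkℚᵘ` stores the denominator minus one.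
      quotient = fromℚᵘ (mkℚᵘ (ℤ.+ (48 * T)) d)
      z = ℤ.+ (48 * T) ℤ.- ℤ.+ suc d

    quotient*target : quotient ℚ.* target B ≡ fromℕ T
    quotient*target = ℚ.toℚᵘ-injective (begin
      toℚᵘ (quotient ℚ.* target B)
        ≈⟨ ℚ.toℚᵘ-homo-* quotient (target B) ⟩
      toℚᵘ quotient ℚᵘ.* toℚᵘ (target B)
        ≈⟨ ℚᵘ.*-cong (ℚ.toℚᵘ-fromℚᵘ (mkℚᵘ (ℤ.+ (48 * T)) d))
             (ℚᵘ.≃-trans (ℚ.toℚᵘ-homo-* (ℤ.+ 5 ℚ./ 48) (fromℕ B)) (ℚᵘ.*-congˡ {mkℚᵘ (ℤ.+ 5) 47} (ℚ.toℚᵘ-fromℚᵘ (mkℚᵘ (ℤ.+ B) 0)))) ⟩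
      mkℚᵘ (ℤ.+ (48 * T)) d ℚᵘ.* (mkℚᵘ (ℤ.+ 5) 47 ℚᵘ.* mkℚᵘ (ℤ.+ B) 0)
        ≈⟨ *≡* cross ⟩
      mkℚᵘ (ℤ.+ T) 0
        ≈⟨ ℚ.toℚᵘ-fromℚᵘ (mkℚᵘ (ℤ.+ T) 0) ⟨
      toℚᵘ (fromℕ T) ∎)
      where
      open import Relation.Binary.Reasoning.Setoid ℚᵘ.≃-setoid
      cross : ℤ.+ (48 * T) ℤ.* (ℤ.+ 5 ℤ.* ℤ.+ B) ℤ.* ℤ.+ 1 ≡ ℤ.+ T ℤ.* ℤ.+ (suc d * 48)
      cross = trans (ℤ.*-identityʳ _) (trans (cong (ℤ.+ (48 * T) ℤ.*_) (sym (ℤ.pos-* 5 B)))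
        (trans (sym (ℤ.pos-* (48 * T) (5 * B))) (trans (cong ℤ.+_ (trans (ring T (5 * B)) (cong (λ D → T * (D * 48)) (sym D≡5B))))
          (ℤ.pos-* T (suc d * 48)))))
        where
        ring : ∀ t x → 48 * t * x ≡ t * (x * 48)
        ring = solve-∀

    quotient-1 : quotient ℚ.- 1ℚ ≡ fromℚᵘ (mkℚᵘ z d)
    quotient-1 = ℚ.toℚᵘ-injective (begin
      toℚᵘ (quotient ℚ.- 1ℚ)
        ≈⟨ ℚ.toℚᵘ-homo-+ quotient (ℚ.- 1ℚ) ⟩
      toℚᵘ quotient ℚᵘ.+ toℚᵘ (ℚ.- 1ℚ)
        ≈⟨ ℚᵘ.+-congˡ (toℚᵘ (ℚ.- 1ℚ)) (ℚ.toℚᵘ-fromℚᵘ (mkℚᵘ (ℤ.+ (48 * T)) d)) ⟩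
      mkℚᵘ (ℤ.+ (48 * T)) d ℚᵘ.+ toℚᵘ (ℚ.- 1ℚ)
        ≈⟨ *≡* (cong₂ ℤ._*_ (ring (ℤ.+ (48 * T)) (ℤ.+ suc d)) (cong ℤ.+_ (sym (*-identityʳ (suc d))))) ⟩
      mkℚᵘ z d
        ≈⟨ ℚ.toℚᵘ-fromℚᵘ (mkℚᵘ z d) ⟨
      toℚᵘ (fromℚᵘ (mkℚᵘ z d)) ∎)
      where
      open import Relation.Binary.Reasoning.Setoid ℚᵘ.≃-setoid
      ring : ∀ x y → x ℤ.* ℤ.+ 1 ℤ.+ ℤ.-[1+ 0 ] ℤ.* y ≡ x ℤ.- y
      ring = ℤSolver.solve-∀

    quotient-target : .{{_ : ℚ.NonZero (target B)}} → fromℕ T ℚ.÷ target B ≡ quotient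
    quotient-target = begin
      fromℕ T ℚ.* (ℚ.1/ target B)                   ≡⟨ cong (ℚ._* (ℚ.1/ target B)) quotient*target ⟨
      quotient ℚ.* target B ℚ.* (ℚ.1/ target B)     ≡⟨ ℚ.*-assoc quotient (target B) (ℚ.1/ target B) ⟩
      quotient ℚ.* (target B ℚ.* (ℚ.1/ target B))   ≡⟨ cong (quotient ℚ.*_) (ℚ.*-inverseʳ (target B)) ⟩
      quotient ℚ.* 1ℚ                               ≡⟨ ℚ.*-identityʳ quotient ⟩
      quotient                                      ∎
      where open ≡-Reasoning

    -- The numerator of a positive δ is at least 1, so it suffices that |z| / (5 B) is below the
    -- reciprocal of its denominator.
    quotient-close : .{{_ : ℚ.NonZero (target B)}} → ∀ δ → 0ℚ ℚ.< δ → ℤ.∣ z ∣ * ℚ.↧ₙ δ < 5 * B →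
      ℚ.∣ fromℕ T ℚ.÷ target B ℚ.- 1ℚ ∣ ℚ.< δ
    quotient-close δ@(mkℚ ℤ.+[1+ p ] q _) 0<δ close = subst (λ x → ℚ.∣ x ∣ ℚ.< δ) (sym (trans (cong (ℚ._- 1ℚ) quotient-target) quotient-1))
      (ℚ.toℚᵘ-cancel-< (ℚᵘ.<-respˡ-≃ (ℚᵘ.≃-sym (ℚᵘ.≃-trans (ℚ.toℚᵘ-homo-∣-∣ (fromℚᵘ (mkℚᵘ z d))) (ℚᵘ.∣-∣-cong (ℚ.toℚᵘ-fromℚᵘ (mkℚᵘ z d)))))
        (*<* cross)))
      where
      cross : ℤ.+ ℤ.∣ z ∣ ℤ.* ℤ.+ suc q ℤ.< ℤ.+ suc p ℤ.* ℤ.+ suc d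
      cross = subst₂ ℤ._<_ (ℤ.pos-* ℤ.∣ z ∣ (suc q)) (ℤ.pos-* (suc p) (suc d))
        (ℤ.+<+ (<-≤-trans close (≤-trans (≤-reflexive (sym D≡5B)) (m≤m+n (suc d) (p * suc d)))))
    quotient-close (mkℚ (ℤ.+ 0) q _) (ℚ.*<* (ℤ.+<+ ()))
    quotient-close (mkℚ ℤ.-[1+ p ] q _) (ℚ.*<* ())

  asymptotic : (λ n → fromℕ (N-bi-total n (ℤ.+ 2))) ∼ (λ n → target (n ^ suc n))
  asymptotic δ 0<δ = k * k , bound
    where
    q = ℚ.↧ₙ δ
    -- The error bound leaves 66 B to be compared with 5 B times this factor, and 14 is the least
    -- one with 66 < 5 * 14.
    k = 14 * q
    bound : ∀ n → k * k ≤ n → Σ[ b≢0 ∈ ℚ.NonZero (target (n ^ suc n)) ]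
      ℚ.∣ ℚ._÷_ (fromℕ (N-bi-total n (ℤ.+ 2))) (target (n ^ suc n)) {{b≢0}} ℚ.- 1ℚ ∣ ℚ.< δ
    -- The denominator of δ is positive, so k * k ≤ 0 is impossible.
    bound zero    ()
    bound (suc m) k²≤n = nz , quotient-close T (pred (5 * B)) B (suc-pred (5 * B) {{m*n≢0 5 B}}) {{nz}} δ 0<δ
      (*-cancelˡ-< 14 _ _ (begin-strict
        14 * (∣z∣ * q)  ≡⟨ ring ∣z∣ q ⟩
        k * ∣z∣         ≤⟨ *-monoʳ-≤ k ∣z∣≤ ⟩
        k * error m     ≤⟨ k*error≤ m k (≤-trans k²≤n (≤-reflexive (+-comm 1 m))) ⟩
        66 * B′         ≡⟨ cong (66 *_) B≡B′ ⟨
        66 * B          <⟨ *-monoˡ-< B {66} {70} (m≤m+n 67 3) ⟩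
        70 * B          ≡⟨ ring′ B ⟩
        14 * (5 * B)    ∎))
      where
      open ≤-Reasoning
      T = N-bi-total (suc m) (ℤ.+ 2)
      B = suc m ^ (2 + m)
      B′ = (m + 1) * ((m + 1) * (m + 1) ^ m)
      instance
        B≢0 : NonZero B
        B≢0 = m^n≢0 (suc m) (2 + m)
      nz = target-nonZero B
      B≡B′ : B ≡ B′
      B≡B′ = cong (λ N → N * (N * N ^ m)) (+-comm 1 m)
      ∣z∣ = ℤ.∣ ℤ.+ (48 * T) ℤ.- ℤ.+ suc (pred (5 * B)) ∣
      5B≡ : suc (pred (5 * B)) ≡ 5 * B′
      5B≡ = trans (suc-pred (5 * B) {{m*n≢0 5 B}}) (cong (5 *_) B≡B′)
      ∣z∣≤ : ∣z∣ ≤ error m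
      ∣z∣≤ = subst (λ D → ℤ.∣ ℤ.+ (48 * T) ℤ.- ℤ.+ D ∣ ≤ error m) (sym 5B≡)
        (∣⊖∣≤ (N-bi-total-upper m) (N-bi-total-lower m))
      ring : ∀ z q → 14 * (z * q) ≡ 14 * q * z
      ring = solve-∀
      ring′ : ∀ b → 70 * b ≡ 14 * (5 * b)
      ring′ = solve-∀

open import Data.Nat.Base using (suc; _^_)
open import Data.Integer.Base using (+_)
open import Data.Rational.Base using (_/_; _*_)

theorem1p4 : (λ n → fromℕ (N-bi-total n (+ 2))) ∼ (λ n → (+ 5 / 48) * fromℕ (n ^ suc n))
theorem1p4 = BicyclicCount.asymptotic
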